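{- Let $k\geq 1$ be an integer, let $q$ be a power of an odd prime, and let $E\subset\mathbb{F}_q^2$ satisfy $|E|\gtrsim q^{s}$, where $s=2-\frac{1}{k+1}$. Then $|\mathcal{C}_{k+1}(E)|\gtrsim |\mathcal{C}_{k+1}(\mathbb{F}_q^2)|$.
   Context: For a commutative ring $R$ and $x=(x_1,x_2),y=(y_1,y_2)\in R^2$, write $y^\perp=(y_2,-y_1)$, so $x\cdot y^\perp=x_1y_2-x_2y_1$. A $(k+1)$-point configuration is an element $x=(x^1,\dots,x^{k+1})\in (R^2)^{k+1}$. For $E\subset R^2$, define an equivalence relation $\sim$ on $E^{k+1}$ by $x\sim y$ iff $x^i\cdot x^{j\perp}=y^i\cdot y^{j\perp}$ for every pair of indices $i,j$; $\mathcal{C}_{k+1}(E)$ denotes the set of equivalence classes of $E^{k+1}$ under $\sim$. The notation $X\lesssim Y$ (equivalently $Y\gtrsim X$) means $X\leq CY$ for a constant $C$ independent of $q$ and $E$ (it may depend on $k$); the hypothesis $|E|\gtrsim q^s$ means $|E|\geq Cq^s$ for a sufficiently large such constant. -}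

module Defs where

open import Algebra.Bundles using (CommutativeRing)
open import Data.Fin.Base using (Fin)
open import Data.Fin.Properties using (all?)
open import Data.List.Base using (List; []; _∷_; length; deduplicate; cartesianProduct; cartesianProductWith)
open import Data.List.Membership.Setoid.Properties using (∈-cartesianProductWith⁺)
open import Data.List.Relation.Unary.Any as Any using (here; there)
open import Data.List.Relation.Unary.Enumerates.Setoid using (IsEnumeration)
open import Data.List.Relation.Unary.Enumerates.Setoid.Properties using (cartesianProduct⁺)
open import Data.Nat.Base using (ℕ; zero; suc; _*_; _^_; _≤_; NonZero)
open import Data.Product.Base using (∃; _×_; _,_; proj₁; proj₂)
open import Data.Product.Relation.Binary.Pointwise.NonDependent using (×-decSetoid)
open import Data.Unit.Base using (tt)
open import Data.Vec.Functional as Vector using (Vector; head; tail)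
import Data.Vec.Functional.Relation.Binary.Pointwise.Properties as Pointwise
open import Level using (Level; _⊔_; 0ℓ) renaming (suc to lsuc)
open import Relation.Binary.Bundles using (DecSetoid)
open import Relation.Binary.Core using (Rel; _⇒_)
open import Relation.Binary.Definitions using (Decidable; _Respects_)
import Relation.Binary.Construct.On as On
open import Relation.Binary.Structures using (IsDecEquivalence)
open import Relation.Nullary using (¬_; yes; no; contradiction)
import Relation.Unary as Unary

private
  variable
    a b c e ℓ ℓ₁ ℓ₂ : Level

------------------------------------------------------------------------
-- Finite sets and their cardinalities

record FiniteSetoid a ℓ : Set (lsuc (a ⊔ ℓ)) where
  field
    decSetoid : DecSetoid a ℓ

  open DecSetoid decSetoid public

  -- The list may contain repetitions.
  field
    elements : List Carrier
    complete : IsEnumeration setoid elements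

-- The number of elements up to _≈_.
∣_∣ : FiniteSetoid a ℓ → ℕ
∣ S ∣ = length (deduplicate _≟_ elements)
  where open FiniteSetoid S

infixr 2 _×ᶠ_

_×ᶠ_ : FiniteSetoid a ℓ₁ → FiniteSetoid b ℓ₂ → FiniteSetoid (a ⊔ b) (ℓ₁ ⊔ ℓ₂)
S ×ᶠ T = record
  { decSetoid = ×-decSetoid S.decSetoid T.decSetoid
  ; elements  = cartesianProduct S.elements T.elements
  ; complete  = cartesianProduct⁺ S.setoid T.setoid S.complete T.complete
  }
  where
  module S = FiniteSetoid S
  module T = FiniteSetoid T

module _ (S : FiniteSetoid a ℓ) where
  open FiniteSetoid S

  vectors : ∀ n → List (Vector Carrier n)
  vectors zero    = Vector.[] ∷ []
  vectors (suc n) = cartesianProductWith Vector._∷_ elements (vectors n)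

  vectors-complete : ∀ n → IsEnumeration (Pointwise.setoid setoid n) (vectors n)
  vectors-complete zero    v = here λ ()
  vectors-complete (suc n) v = Any.map
    (λ eq → λ { Fin.zero → eq Fin.zero ; (Fin.suc i) → eq (Fin.suc i) })
    (∈-cartesianProductWith⁺ setoid (Pointwise.setoid setoid n) (Pointwise.setoid setoid (suc n))
      (λ x≈y xs≋ys → λ { Fin.zero → x≈y ; (Fin.suc i) → xs≋ys i })
      (complete (head v)) (vectors-complete n (tail v)))

  power : ℕ → FiniteSetoid a ℓ
  power n = record
    { decSetoid = Pointwise.decSetoid decSetoid n
    ; elements  = vectors n
    ; complete  = vectors-complete n
    }

  record Subset e : Set (a ⊔ ℓ ⊔ lsuc e) where
    field
      member   : Unary.Pred Carrier e
      member?  : Unary.Decidable member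
      respects : member Respects _≈_

  whole : Subset 0ℓ
  whole = record { member = Unary.U ; member? = λ _ → yes tt ; respects = λ _ _ → tt }

  module _ (E : Subset e) where
    open Subset E

    private
      subDecSetoid : DecSetoid (a ⊔ e) ℓ
      subDecSetoid = On.decSetoid decSetoid (proj₁ {B = member})

    members : List Carrier → List (∃ member)
    members [] = []
    members (x ∷ xs) with member? x
    ... | yes x∈E = (x , x∈E) ∷ members xs
    ... | no  _   = members xs

    members-complete : ∀ ((x , _) : ∃ member) {xs} → Any.Any (x ≈_) xs →
                       Any.Any (λ y → x ≈ proj₁ y) (members xs)
    members-complete (x , x∈E) {y ∷ _} (here x≈y) with member? y
    ... | yes _   = here x≈y
    ... | no  y∉E = contradiction (respects x≈y x∈E) y∉E
    members-complete x {y ∷ _} (there x∈xs) with member? y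
    ... | yes _ = there (members-complete x x∈xs)
    ... | no  _ = members-complete x x∈xs

    subset : FiniteSetoid (a ⊔ e) ℓ
    subset = record
      { decSetoid = subDecSetoid
      ; elements  = members elements
      ; complete  = λ x → members-complete x (complete (proj₁ x))
      }

  -- The elements of the quotient are those of S, identified when related by
  -- _∼_, so that its cardinality is the number of equivalence classes.
  quotient : {_∼_ : Rel Carrier ℓ₁} → IsDecEquivalence _∼_ → _≈_ ⇒ _∼_ → FiniteSetoid a ℓ₁
  quotient ∼-isDecEquivalence ≈⇒∼ = record
    { decSetoid = record { isDecEquivalence = ∼-isDecEquivalence }
    ; elements  = elements
    ; complete  = λ x → Any.map ≈⇒∼ (complete x)
    }

------------------------------------------------------------------------
-- Plane geometry over a commutative ring

module Plane (R : CommutativeRing c ℓ) where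
  open CommutativeRing R renaming (_*_ to _*ᴿ_)

  Point : Set c
  Point = Carrier × Carrier

  infix  8 _⊥
  infixl 7 _·_
  infix  4 _∼_

  _⊥ : Point → Point
  (y₁ , y₂) ⊥ = y₂ , - y₁

  _·_ : Point → Point → Carrier
  (x₁ , x₂) · (y₁ , y₂) = x₁ *ᴿ y₁ + x₂ *ᴿ y₂

  _∼_ : ∀ {n} → Rel (Vector Point n) ℓ
  x ∼ y = ∀ i j → x i · x j ⊥ ≈ y i · y j ⊥

------------------------------------------------------------------------
-- Finite fields

record FiniteField c ℓ : Set (lsuc (c ⊔ ℓ)) where
  field
    commutativeRing : CommutativeRing c ℓ

  open CommutativeRing commutativeRing public renaming (_*_ to _*ᴿ_)

  field
    1≉0      : ¬ 1# ≈ 0#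
    inverse  : ∀ x → ¬ x ≈ 0# → ∃ λ y → x *ᴿ y ≈ 1#
    _≟_      : Decidable _≈_
    elements : List Carrier
    complete : IsEnumeration setoid elements

  finiteSetoid : FiniteSetoid c ℓ
  finiteSetoid = record
    { decSetoid = record
      { isDecEquivalence = record { isEquivalence = isEquivalence ; _≟_ = _≟_ } }
    ; elements = elements
    ; complete = complete
    }

  order : ℕ
  order = ∣ finiteSetoid ∣

  plane : FiniteSetoid c ℓ
  plane = finiteSetoid ×ᶠ finiteSetoid

module _ (F : FiniteField c ℓ) where
  open FiniteField F
  open Plane commutativeRing

  -- classes n E is 𝒞ₙ(E).
  classes : (n : ℕ) → Subset plane e → FiniteSetoid (c ⊔ e) ℓ
  classes n E = quotient (power (subset plane E) n) {_∼_ = λ x y → points x ∼ points y}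
    (record
      { isEquivalence = record
        { refl  = λ i j → refl
        ; sym   = λ x∼y i j → sym (x∼y i j)
        ; trans = λ x∼y y∼z i j → trans (x∼y i j) (y∼z i j)
        }
      ; _≟_ = λ x y → all? λ i → all? λ j → _ ≟ _
      })
    (λ x≋y i j → +-cong
      (*-cong (proj₁ (x≋y i)) (proj₂ (x≋y j)))
      (*-cong (proj₂ (x≋y i)) (-‿cong (proj₁ (x≋y j)))))
    where
    points : Vector (∃ (Subset.member E)) n → Vector Point n
    points = Vector.map proj₁

------------------------------------------------------------------------
-- Bounds with a rational exponent

-- N ≥ C · q^(r / d), with both sides raised to the power d.
_≥_·_^[_/_] : (N C q r d : ℕ) .{{_ : NonZero d}} → Set
N ≥ C · q ^[ r / d ] = C ^ d * q ^ r ≤ N ^ d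

-- Let n be the number of nonzero points of E, let G be SL₂ over the field with q elements, and let
-- f(g) be the number of nonzero points of E that g ∈ G maps into E.  Tuples with the same areas, two
-- of whose members are independent, differ by an element of G, so by Cauchy–Schwarz
-- n^(2(k+1)) ≲ |𝒞ₖ₊₁(E)| · Σ f^(k+1).  The mean of f is about n²/q².  Its variance is governed by the
-- second moment of ν(t), the number of pairs of points spanning area t: counting incidences with
-- lines gives Σ (ν − n²/q)² ≤ q²n², hence Σ (f − n²/q²)² ≤ 2q²n².  As f ≤ n, it follows that
-- Σ f^(k+1) ≲ q³(n²/q²)^(k+1) + n^(k-1) q²n², where the first term dominates once n^(k+1) ≳ q^(2k+1).
-- Thus |𝒞ₖ₊₁(E)| ≳ q^(2k-1), and normalising two independent members shows that
-- |𝒞ₖ₊₁(F²)| ≲ q^(2k-1).  All inequalities are cleared of denominators to live in ℕ.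

module Submission where

open import Algebra.Bundles using (CommutativeRing; RawRing)
import Algebra.Properties.AbelianGroup as AbelianGroupProperties
import Algebra.Properties.Group as GroupProperties
import Algebra.Properties.Ring as RingProperties
import Algebra.Properties.Semiring.Mult as SemiringMult
import Algebra.Solver.Ring as RingSolver
open import Algebra.Solver.Ring.AlmostCommutativeRing
  using (Induced-equivalence; _-Raw-AlmostCommutative⟶_; fromCommutativeRing)
import Algebra.Solver.Ring.NaturalCoefficients.Default as NatCoeff
open import Data.Maybe.Base using (just; nothing)
open import Data.Nat.Base as ℕ using (ℕ)
import Data.Nat.Properties as ℕ
open import Data.Product.Base using (_×_; _,_; proj₁; proj₂; ∃)
open import Defs
open import Level using (Level; 0ℓ)
open import Relation.Binary.Definitions using (WeaklyDecidable)
open import Relation.Binary.PropositionalEquality as ≡ using (_≡_)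
import Relation.Binary.Reasoning.Setoid as SetoidReasoning
open import Relation.Nullary using (¬_; Dec; yes; no; does; contradiction; ¬?; _×-dec_)

-- The origin is discarded because every element of SL₂ fixes it, while between any two nonzero
-- vectors there are exactly `q` transporters; this uniformity gives the mean of `f`. Tuples whose
-- two leading entries are dependent are discarded because equal areas need not give a group
-- element: all tuples on one line through the origin have zero areas. No characters are needed for
-- the incidence bound. The deviation from the mean is summed over every `x` of the plane, where the
-- main terms cancel exactly and only the diagonal pairs of points survive. Deviations are written
-- `∣ c * φ x - m ∣ ²`, with the cross term of the expanded square moved to the other side. Hence a
-- lower bound on the sum of `f` and an upper bound on the order of SL₂ suffice. The passage from
-- variance to higher moments separates the values of `f` above twice its mean: there `f` is at most
-- twice its deviation. Throughout, `k` is `1 + m`, so that tuples have length `2 + m`,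
-- `q * (q ²) ^ m` is q^(2k-1) and `q * q ² * (q ²) ^ m` is q^(2k+1).

-- The coefficient (m , n) stands for the integer m - n.
module IntegerCoefficients {c ℓ} (R : CommutativeRing c ℓ) where
  open CommutativeRing R
  private
    module R = RingProperties ring
    open AbelianGroupProperties +-abelianGroup using (⁻¹-∙-comm)
    open SemiringMult semiring using (×-homo-+; ×1-homo-*) renaming (_×_ to _·_)
    open NatCoeff commutativeSemiring using (solve; _:+_; _:*_; _:=_)

    coefficients : RawRing 0ℓ 0ℓ
    coefficients = record
      { Carrier = ℕ × ℕ
      ; _≈_     = _≡_
      ; _+_     = λ (a , b) (c , d) → a ℕ.+ c , b ℕ.+ d
      ; _*_     = λ (a , b) (c , d) → a ℕ.* c ℕ.+ b ℕ.* d , a ℕ.* d ℕ.+ b ℕ.* c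
      ; -_      = λ (a , b) → b , a
      ; 0#      = 0 , 0
      ; 1#      = 1 , 0
      }

    _·1 : ℕ → Carrier
    n ·1 = n · 1#

    ⟦_⟧ : ℕ × ℕ → Carrier
    ⟦ a , b ⟧ = a ·1 + - (b ·1)

    homo-+* : ∀ a b c d → (a ℕ.* b ℕ.+ c ℕ.* d) ·1 ≈ (a ·1) * (b ·1) + (c ·1) * (d ·1)
    homo-+* a b c d = trans (×-homo-+ 1# (a ℕ.* b) (c ℕ.* d)) (+-cong (×1-homo-* a b) (×1-homo-* c d))

    neg*neg : ∀ x y → - x * - y ≈ x * y
    neg*neg x y = trans (sym (R.-‿distribʳ-* (- x) y))
      (trans (-‿cong (sym (R.-‿distribˡ-* x y))) (R.-‿involutive _))

    open SetoidReasoning setoid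

    homomorphism : coefficients -Raw-AlmostCommutative⟶ fromCommutativeRing R
    homomorphism = record
      { ⟦_⟧    = ⟦_⟧
      ; +-homo = λ (a , b) (c , d) → begin
          (a ℕ.+ c) ·1 + - ((b ℕ.+ d) ·1)
            ≈⟨ +-cong (×-homo-+ 1# a c) (trans (-‿cong (×-homo-+ 1# b d)) (sym (⁻¹-∙-comm _ _))) ⟩
          (a ·1 + c ·1) + (- (b ·1) + - (d ·1))
            ≈⟨ solve 4 (λ a b c d → (a :+ c) :+ (b :+ d) := (a :+ b) :+ (c :+ d)) refl
                 (a ·1) (- (b ·1)) (c ·1) (- (d ·1)) ⟩
          ⟦ a , b ⟧ + ⟦ c , d ⟧ ∎
      ; *-homo = λ (a , b) (c , d) → begin
          (a ℕ.* c ℕ.+ b ℕ.* d) ·1 + - ((a ℕ.* d ℕ.+ b ℕ.* c) ·1)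
            ≈⟨ +-cong (homo-+* a c b d) (trans (-‿cong (homo-+* a d b c)) (sym (⁻¹-∙-comm _ _))) ⟩
          ((a ·1) * (c ·1) + (b ·1) * (d ·1)) + (- ((a ·1) * (d ·1)) + - ((b ·1) * (c ·1)))
            ≈⟨ +-cong (+-congˡ (sym (neg*neg _ _)))
                 (+-cong (R.-‿distribʳ-* _ _) (R.-‿distribˡ-* _ _)) ⟩
          ((a ·1) * (c ·1) + - (b ·1) * - (d ·1)) + ((a ·1) * - (d ·1) + - (b ·1) * (c ·1))
            ≈⟨ solve 4 (λ a b c d → (a :* c :+ b :* d) :+ (a :* d :+ b :* c) := (a :+ b) :* (c :+ d)) refl
                 (a ·1) (- (b ·1)) (c ·1) (- (d ·1)) ⟩
          ⟦ a , b ⟧ * ⟦ c , d ⟧ ∎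
      ; -‿homo = λ (a , b) → begin
          b ·1 + - (a ·1)       ≈⟨ +-comm _ _ ⟩
          - (a ·1) + b ·1       ≈⟨ +-congˡ (R.-‿involutive _) ⟨
          - (a ·1) + - - (b ·1) ≈⟨ ⁻¹-∙-comm _ _ ⟩
          - ⟦ a , b ⟧           ∎
      ; 0-homo = -‿inverseʳ 0#
      ; 1-homo = trans (+-congˡ R.-0#≈0#) (trans (+-identityʳ _) (+-identityʳ 1#))
      }

    -- Cancellation produces coefficients such as `(1 , 1)`, which must be recognised as `(0 , 0)`;
    -- hence pairs are compared as integers. Answering `nothing` otherwise is sound even if the two
    -- integers agree in the characteristic of `R`.
    _≟_ : WeaklyDecidable (Induced-equivalence homomorphism)
    (a , b) ≟ (c , d) with a ℕ.+ d ℕ.≟ c ℕ.+ b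
    ... | no  _ = nothing
    ... | yes a+d≡c+b = just (begin
      a ·1 + - (b ·1)
        ≈⟨ trans (+-congˡ (+-congˡ (-‿inverseʳ _))) (+-congˡ (+-identityʳ _)) ⟨
      a ·1 + (- (b ·1) + (d ·1 + - (d ·1)))
        ≈⟨ solve 4 (λ a b d e → a :+ (b :+ (d :+ e)) := (a :+ d) :+ (b :+ e)) refl _ _ _ _ ⟩
      (a ·1 + d ·1) + (- (b ·1) + - (d ·1))
        ≈⟨ +-congʳ (trans (sym (×-homo-+ 1# a d))
             (trans (reflexive (≡.cong _·1 a+d≡c+b)) (×-homo-+ 1# c b))) ⟩
      (c ·1 + b ·1) + (- (b ·1) + - (d ·1))
        ≈⟨ solve 4 (λ c b e f → (c :+ b) :+ (e :+ f) := c :+ ((b :+ e) :+ f)) refl _ _ _ _ ⟩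
      c ·1 + ((b ·1 + - (b ·1)) + - (d ·1))
        ≈⟨ +-congˡ (trans (+-congʳ (-‿inverseʳ _)) (+-identityˡ _)) ⟩
      c ·1 + - (d ·1) ∎)

  open RingSolver coefficients (fromCommutativeRing R) homomorphism _≟_ public
    using (solve; _:=_; _:+_; _:*_; _:-_; :-_; con; Polynomial)

-- Determinants and unimodular maps of the plane

module PlaneGeometry {c ℓ} (F : FiniteField c ℓ) where
  open FiniteField F
    using (_+_; _*ᴿ_; -_; refl; sym; trans; +-cong; +-congˡ; +-congʳ; *-cong; *-congˡ; *-congʳ;
           -‿cong; zeroˡ; zeroʳ; +-identityˡ; +-identityʳ; -‿inverseʳ; *-identityˡ; *-identityʳ; *-comm;
           inverse; setoid; commutativeRing)
  open FiniteField F public using (Carrier; _≈_; 0#; 1#; 1≉0; plane; order; finiteSetoid)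
  open Plane commutativeRing public using (Point; _∼_; _⊥; _·_)
  open RingProperties (CommutativeRing.ring commutativeRing) using (-0#≈0#; -‿involutive)
  open GroupProperties (CommutativeRing.+-group commutativeRing) using (x∙y⁻¹≈ε⇒x≈y)
  open IntegerCoefficients commutativeRing
  open SetoidReasoning setoid
  private
    module plane = FiniteSetoid plane

  infix 4 _≈ₚ_
  _≈ₚ_ : Point → Point → Set ℓ
  _≈ₚ_ = plane._≈_

  infixl 7 _∧_
  _∧_ : Point → Point → Carrier
  x ∧ y = x · y ⊥

  infixl 6 _+ₚ_
  _+ₚ_ : Point → Point → Point
  (x₁ , x₂) +ₚ (y₁ , y₂) = x₁ + y₁ , x₂ + y₂

  infixl 7 _*ₚ_
  _*ₚ_ : Carrier → Point → Point
  a *ₚ (x₁ , x₂) = a *ᴿ x₁ , a *ᴿ x₂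

  0ₚ : Point
  0ₚ = 0# , 0#

  -- The pair (u , v) is the matrix with columns u and v, of determinant u ∧ v.
  infixr 8 _∙_
  _∙_ : Point × Point → Point → Point
  (u , v) ∙ (a , b) = a *ₚ u +ₚ b *ₚ v

  private
    -- Syntactic copies of the plane operations, so that identities reach the solver in geometric
    -- notation.
    Point′ : ℕ → Set
    Point′ n = Polynomial n × Polynomial n
    infixl 8 _∧′_ _*′_
    infixl 7 _+′_
    _∧′_ : ∀ {n} → Point′ n → Point′ n → Polynomial n
    (x₁ , x₂) ∧′ (y₁ , y₂) = x₁ :* y₂ :+ x₂ :* (:- y₁)
    _+′_ : ∀ {n} → Point′ n → Point′ n → Point′ n
    (x₁ , x₂) +′ (y₁ , y₂) = x₁ :+ y₁ , x₂ :+ y₂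
    _*′_ : ∀ {n} → Polynomial n → Point′ n → Point′ n
    a *′ (x₁ , x₂) = a :* x₁ , a :* x₂
    _∙′_ : ∀ {n} → Point′ n × Point′ n → Point′ n → Point′ n
    (u , v) ∙′ (a , b) = a *′ u +′ b *′ v

  ∧-cong : ∀ {x x′ y y′} → x ≈ₚ x′ → y ≈ₚ y′ → x ∧ y ≈ x′ ∧ y′
  ∧-cong (p₁ , p₂) (q₁ , q₂) = +-cong (*-cong p₁ q₂) (*-cong p₂ (-‿cong q₁))

  ∧-self : ∀ x → x ∧ x ≈ 0#
  -- The constant `con (0 , 0)` evaluates to `0# + - 0#`, which the last step reduces.
  ∧-self (x₁ , x₂) = trans (solve 2 (λ x₁ x₂ → (x₁ , x₂) ∧′ (x₁ , x₂) := con (0 , 0)) refl x₁ x₂) (-‿inverseʳ 0#)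

  ∧-zeroˡ : ∀ x → 0ₚ ∧ x ≈ 0#
  ∧-zeroˡ x = trans (+-cong (zeroˡ _) (zeroˡ _)) (+-identityʳ 0#)

  -- Multiplicativity of the determinant, `x ∧ y` being that of the matrix with columns `x` and `y`.
  ∧-∙ : ∀ g x y → (g ∙ x) ∧ (g ∙ y) ≈ (proj₁ g ∧ proj₂ g) *ᴿ (x ∧ y)
  ∧-∙ ((u₁ , u₂) , (v₁ , v₂)) (x₁ , x₂) (y₁ , y₂) = solve 8
    (λ u₁ u₂ v₁ v₂ x₁ x₂ y₁ y₂ → let u = u₁ , u₂; v = v₁ , v₂; x = x₁ , x₂; y = y₁ , y₂; g = u , v in
      (g ∙′ x) ∧′ (g ∙′ y) := (u ∧′ v) :* (x ∧′ y))
    refl u₁ u₂ v₁ v₂ x₁ x₂ y₁ y₂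

  cramer : ∀ x y z → (x ∧ y) *ₚ z ≈ₚ (z ∧ y) *ₚ x +ₚ (x ∧ z) *ₚ y
  cramer (x₁ , x₂) (y₁ , y₂) (z₁ , z₂) =
    solve 6 (λ x₁ x₂ y₁ y₂ z₁ z₂ → let x = x₁ , x₂; y = y₁ , y₂; z = z₁ , z₂ in
      (x ∧′ y) :* z₁ := (z ∧′ y) :* x₁ :+ (x ∧′ z) :* y₁) refl x₁ x₂ y₁ y₂ z₁ z₂ ,
    solve 6 (λ x₁ x₂ y₁ y₂ z₁ z₂ → let x = x₁ , x₂; y = y₁ , y₂; z = z₁ , z₂ in
      (x ∧′ y) :* z₂ := (z ∧′ y) :* x₂ :+ (x ∧′ z) :* y₂) refl x₁ x₂ y₁ y₂ z₁ z₂

  -- The map `z ↦ (d *ᴿ (z ∧ y) , x ∧ z)` is linear with determinant `d *ᴿ (x ∧ y)`. For `d = 1#`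
  -- this is the Plücker relation; with `d` inverse to `x ∧ y` the map preserves areas and
  -- normalises `x` and `y`.
  plücker : ∀ d x y z w → (d *ᴿ (z ∧ y) , x ∧ z) ∧ (d *ᴿ (w ∧ y) , x ∧ w) ≈ (d *ᴿ (x ∧ y)) *ᴿ (z ∧ w)
  plücker d (x₁ , x₂) (y₁ , y₂) (z₁ , z₂) (w₁ , w₂) = solve 9
    (λ d x₁ x₂ y₁ y₂ z₁ z₂ w₁ w₂ → let x = x₁ , x₂; y = y₁ , y₂; z = z₁ , z₂; w = w₁ , w₂ in
      (d :* (z ∧′ y) , x ∧′ z) ∧′ (d :* (w ∧′ y) , x ∧′ w) := (d :* (x ∧′ y)) :* (z ∧′ w))
    refl d x₁ x₂ y₁ y₂ z₁ z₂ w₁ w₂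

  *-cancelˡ : ∀ {a x y} → ¬ a ≈ 0# → a *ᴿ x ≈ a *ᴿ y → x ≈ y
  *-cancelˡ {a} {x} {y} a≉0 ax≈ay = let (b , ab≈1) = inverse a a≉0 in begin
    x               ≈⟨ *-identityˡ x ⟨
    1# *ᴿ x         ≈⟨ *-congʳ ab≈1 ⟨
    (a *ᴿ b) *ᴿ x   ≈⟨ solve 3 (λ a b x → (a :* b) :* x := b :* (a :* x)) refl a b x ⟩
    b *ᴿ (a *ᴿ x)   ≈⟨ *-congˡ ax≈ay ⟩
    b *ᴿ (a *ᴿ y)   ≈⟨ solve 3 (λ a b x → (a :* b) :* x := b :* (a :* x)) refl a b y ⟨
    (a *ᴿ b) *ᴿ y   ≈⟨ *-congʳ ab≈1 ⟩
    1# *ᴿ y         ≈⟨ *-identityˡ y ⟩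
    y               ∎

  *ₚ-cancelˡ : ∀ {a x y} → ¬ a ≈ 0# → a *ₚ x ≈ₚ a *ₚ y → x ≈ₚ y
  *ₚ-cancelˡ a≉0 (p , q) = *-cancelˡ a≉0 p , *-cancelˡ a≉0 q

  -- By Cramer's rule the two products are, up to the factor `x ∧ y`, the coordinates in the basis
  -- `x`, `y`.
  ∧-separates : ∀ {x y z w} → ¬ x ∧ y ≈ 0# → x ∧ z ≈ x ∧ w → z ∧ y ≈ w ∧ y → z ≈ₚ w
  ∧-separates {x} {y} {z} {w} x∧y≉0 xz≈xw zy≈wy = *ₚ-cancelˡ x∧y≉0 (plane.trans (cramer x y z)
    (plane.trans (+-cong (*-congʳ zy≈wy) (*-congʳ xz≈xw) , +-cong (*-congʳ zy≈wy) (*-congʳ xz≈xw))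
      (plane.sym (cramer x y w))))

  ∧≉0⇒≉0 : ∀ {x y} → ¬ x ∧ y ≈ 0# → ¬ x ≈ₚ 0ₚ
  ∧≉0⇒≉0 {x} {y} x∧y≉0 x≈0 = x∧y≉0 (trans (∧-cong x≈0 plane.refl) (∧-zeroˡ y))

  -- Supplies the second basis vector that `∧-separates` needs; it comes from inverting whichever
  -- coordinate of `x` is nonzero.
  complement : ∀ x → ¬ x ≈ₚ 0ₚ → ∃ λ y → x ∧ y ≈ 1#
  complement (x₁ , x₂) x≉0 with FiniteField._≟_ F x₁ 0# | FiniteField._≟_ F x₂ 0#
  ... | no x₁≉0 | _ = let (b , x₁b≈1) = inverse x₁ x₁≉0 in
    (0# , b) , trans (+-congˡ (trans (*-congˡ -0#≈0#) (zeroʳ x₂))) (trans (+-identityʳ _) x₁b≈1)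
  ... | yes _ | no x₂≉0 = let (b , x₂b≈1) = inverse x₂ x₂≉0 in
    (- b , 0#) , trans (+-cong (zeroʳ x₁) (*-congˡ (-‿involutive b))) (trans (+-identityˡ _) x₂b≈1)
  ... | yes x₁≈0 | yes x₂≈0 = contradiction (x₁≈0 , x₂≈0) x≉0

  -- Multiplying the matrix with columns `g ∙ x` and `g ∙ y` on the right by the adjugate of the one
  -- with columns `x` and `y` gives back `g`, scaled by `x ∧ y`.
  columns : ∀ g x y → (x ∧ y) *ₚ proj₁ g ≈ₚ proj₂ y *ₚ (g ∙ x) +ₚ (- proj₂ x) *ₚ (g ∙ y) ×
                      (x ∧ y) *ₚ proj₂ g ≈ₚ (- proj₁ y) *ₚ (g ∙ x) +ₚ proj₁ x *ₚ (g ∙ y)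
  columns ((u₁ , u₂) , (v₁ , v₂)) (x₁ , x₂) (y₁ , y₂) = (first u₁ v₁ , first u₂ v₂) , (second u₁ v₁ , second u₂ v₂)
    where
    first : ∀ u v → ((x₁ , x₂) ∧ (y₁ , y₂)) *ᴿ u ≈ y₂ *ᴿ (x₁ *ᴿ u + x₂ *ᴿ v) + (- x₂) *ᴿ (y₁ *ᴿ u + y₂ *ᴿ v)
    first u v = solve 6 (λ x₁ x₂ y₁ y₂ u v → ((x₁ , x₂) ∧′ (y₁ , y₂)) :* u :=
      y₂ :* (x₁ :* u :+ x₂ :* v) :+ (:- x₂) :* (y₁ :* u :+ y₂ :* v)) refl x₁ x₂ y₁ y₂ u v
    second : ∀ u v → ((x₁ , x₂) ∧ (y₁ , y₂)) *ᴿ v ≈ (- y₁) *ᴿ (x₁ *ᴿ u + x₂ *ᴿ v) + x₁ *ᴿ (y₁ *ᴿ u + y₂ *ᴿ v)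
    second u v = solve 6 (λ x₁ x₂ y₁ y₂ u v → ((x₁ , x₂) ∧′ (y₁ , y₂)) :* v :=
      (:- y₁) :* (x₁ :* u :+ x₂ :* v) :+ x₁ :* (y₁ :* u :+ y₂ :* v)) refl x₁ x₂ y₁ y₂ u v

  infixl 7.5 _-ₚ_
  -- Binds tighter than `_∧_`: `y -ₚ z ∧ x` means `(y -ₚ z) ∧ x`.
  _-ₚ_ : Point → Point → Point
  (x₁ , x₂) -ₚ (y₁ , y₂) = x₁ + - y₁ , x₂ + - y₂

  -ₚ≈0 : ∀ {x y} → x -ₚ y ≈ₚ 0ₚ → x ≈ₚ y
  -ₚ≈0 (p₁ , p₂) = x∙y⁻¹≈ε⇒x≈y _ _ p₁ , x∙y⁻¹≈ε⇒x≈y _ _ p₂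

  ∧-difference : ∀ x y z → x ∧ y ≈ x ∧ z → y -ₚ z ∧ x ≈ 0#
  ∧-difference x@(x₁ , x₂) y@(y₁ , y₂) z@(z₁ , z₂) x∧y≈x∧z = begin
    y -ₚ z ∧ x              ≈⟨ solve 6 (λ x₁ x₂ y₁ y₂ z₁ z₂ → let x = x₁ , x₂; y = y₁ , y₂; z = z₁ , z₂ in
                                 (y₁ :- z₁ , y₂ :- z₂) ∧′ x := (x ∧′ z) :- (x ∧′ y)) refl x₁ x₂ y₁ y₂ z₁ z₂ ⟩
    x ∧ z + - (x ∧ y)       ≈⟨ +-congˡ (-‿cong x∧y≈x∧z) ⟩
    x ∧ z + - (x ∧ z)       ≈⟨ -‿inverseʳ _ ⟩
    0#                      ∎

  ∙-congʳ : ∀ {g h} x → proj₁ g ≈ₚ proj₁ h × proj₂ g ≈ₚ proj₂ h → g ∙ x ≈ₚ h ∙ x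
  ∙-congʳ x ((p₁ , p₂) , (q₁ , q₂)) = +-cong (*-congˡ p₁) (*-congˡ q₁) , +-cong (*-congˡ p₂) (*-congˡ q₂)

  -- Shearing `y` along `x` keeps the determinant, and the second product recovers `t`; this yields
  -- `q` distinct completions of `x` with the same determinant.
  ∧-shear : ∀ t x y → x ∧ (t *ₚ x +ₚ y) ≈ x ∧ y × (t *ₚ x +ₚ y) ∧ y ≈ t *ᴿ (x ∧ y)
  ∧-shear t (x₁ , x₂) (y₁ , y₂) =
    solve 5 (λ t x₁ x₂ y₁ y₂ → let x = x₁ , x₂; y = y₁ , y₂ in
      x ∧′ (t *′ x +′ y) := x ∧′ y) refl t x₁ x₂ y₁ y₂ ,
    solve 5 (λ t x₁ x₂ y₁ y₂ → let x = x₁ , x₂; y = y₁ , y₂ in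
      (t *′ x +′ y) ∧′ y := t :* (x ∧′ y)) refl t x₁ x₂ y₁ y₂

  ∙-injective : ∀ {g h x y} → ¬ x ∧ y ≈ 0# → g ∙ x ≈ₚ h ∙ x → g ∙ y ≈ₚ h ∙ y →
                proj₁ g ≈ₚ proj₁ h × proj₂ g ≈ₚ proj₂ h
  ∙-injective {g} {h} {x} {y} x∧y≉0 (p₁ , p₂) (q₁ , q₂) =
    let (g₁ , g₂) = columns g x y ; (h₁ , h₂) = columns h x y in
    *ₚ-cancelˡ x∧y≉0 (plane.trans g₁ (plane.trans
      (+-cong (*-congˡ p₁) (*-congˡ q₁) , +-cong (*-congˡ p₂) (*-congˡ q₂)) (plane.sym h₁))) ,
    *ₚ-cancelˡ x∧y≉0 (plane.trans g₂ (plane.trans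
      (+-cong (*-congˡ p₁) (*-congˡ q₁) , +-cong (*-congˡ p₂) (*-congˡ q₂)) (plane.sym h₂)))

  transporter : ∀ x y x′ y′ → ¬ x ∧ y ≈ 0# → x ∧ y ≈ x′ ∧ y′ →
                ∃ λ g → proj₁ g ∧ proj₂ g ≈ 1# × g ∙ x ≈ₚ x′ × g ∙ y ≈ₚ y′
  transporter x@(x₁ , x₂) y@(y₁ , y₂) x′@(x₁′ , x₂′) y′@(y₁′ , y₂′) x∧y≉0 x∧y≈x′∧y′ =
    g , g-unimodular , (at-x x₁′ y₁′ , at-x x₂′ y₂′) , (at-y x₁′ y₁′ , at-y x₂′ y₂′)
    where
    d = proj₁ (inverse (x ∧ y) x∧y≉0)
    Dd≈1 : (x ∧ y) *ᴿ d ≈ 1#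
    Dd≈1 = proj₂ (inverse (x ∧ y) x∧y≉0)
    -- The matrix with columns `x′`, `y′` times the inverse of the one with columns `x`, `y`,
    -- written as `d` times the adjugate.
    g = d *ₚ (y₂ *ₚ x′ +ₚ (- x₂) *ₚ y′) , d *ₚ ((- y₁) *ₚ x′ +ₚ x₁ *ₚ y′)
    at-x : ∀ a b → x₁ *ᴿ (d *ᴿ (y₂ *ᴿ a + (- x₂) *ᴿ b)) + x₂ *ᴿ (d *ᴿ ((- y₁) *ᴿ a + x₁ *ᴿ b)) ≈ a
    at-x a b = trans (solve 7 (λ x₁ x₂ y₁ y₂ d a b →
        x₁ :* (d :* (y₂ :* a :+ (:- x₂) :* b)) :+ x₂ :* (d :* ((:- y₁) :* a :+ x₁ :* b)) :=
        (((x₁ , x₂) ∧′ (y₁ , y₂)) :* d) :* a) refl x₁ x₂ y₁ y₂ d a b)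
      (trans (*-congʳ Dd≈1) (*-identityˡ a))
    at-y : ∀ a b → y₁ *ᴿ (d *ᴿ (y₂ *ᴿ a + (- x₂) *ᴿ b)) + y₂ *ᴿ (d *ᴿ ((- y₁) *ᴿ a + x₁ *ᴿ b)) ≈ b
    at-y a b = trans (solve 7 (λ x₁ x₂ y₁ y₂ d a b →
        y₁ :* (d :* (y₂ :* a :+ (:- x₂) :* b)) :+ y₂ :* (d :* ((:- y₁) :* a :+ x₁ :* b)) :=
        (((x₁ , x₂) ∧′ (y₁ , y₂)) :* d) :* b) refl x₁ x₂ y₁ y₂ d a b)
      (trans (*-congʳ Dd≈1) (*-identityˡ b))
    g-unimodular : proj₁ g ∧ proj₂ g ≈ 1#
    -- The determinant of `g` is not computed: it multiplies `x ∧ y` into `x′ ∧ y′`, which is the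
    -- same invertible scalar.
    g-unimodular = *-cancelˡ x∧y≉0 (begin
      (x ∧ y) *ᴿ (proj₁ g ∧ proj₂ g)  ≈⟨ *-comm _ _ ⟩
      (proj₁ g ∧ proj₂ g) *ᴿ (x ∧ y)  ≈⟨ ∧-∙ g x y ⟨
      (g ∙ x) ∧ (g ∙ y)               ≈⟨ ∧-cong {g ∙ x} {x′} {g ∙ y} {y′}
                                           (at-x x₁′ y₁′ , at-x x₂′ y₂′) (at-y x₁′ y₁′ , at-y x₂′ y₂′) ⟩
      x′ ∧ y′                         ≈⟨ x∧y≈x′∧y′ ⟨
      x ∧ y                           ≈⟨ *-identityʳ _ ⟨
      (x ∧ y) *ᴿ 1#                   ∎)

import Algebra.Properties.CommutativeMonoid.Sum ℕ.*-1-commutativeMonoid as Product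
open import Data.Bool.Base using (if_then_else_)
open import Data.Fin.Base as Fin using (Fin; punchIn; punchOut)
open import Data.Fin.Properties as Fin using (any?; punchIn-injective; punchIn-punchOut; punchInᵢ≢i)
open import Data.List.Base
  using (List; []; _∷_; [_]; _++_; allFin; cartesianProduct; cartesianProductWith; concatMap; deduplicate; length; map)
open import Data.List.Membership.Propositional.Properties using (∈-allFin; ∈-cartesianProduct⁺)
open import Data.List.Properties using (length-++; length-map; length-tabulate)
open import Data.List.Relation.Unary.All using (All; []; _∷_)
open import Data.List.Relation.Unary.AllPairs using (AllPairs; []; _∷_)
open import Data.List.Relation.Unary.Any as Any using (Any; here; there)
open import Data.List.Relation.Unary.Any.Properties using (cartesianProductWith⁺; concatMap⁺; map⁺)
open import Data.List.Relation.Unary.Enumerates.Setoid.Properties using (cartesianProduct⁺; deduplicate⁺)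
open import Data.List.Relation.Unary.Unique.DecSetoid.Properties using (deduplicate-!)
import Data.List.Relation.Unary.Unique.Setoid.Properties as Unique
open import Data.Nat.Base
open import Data.Nat.ListAction using (sum)
open import Data.Nat.Primality using (Prime)
open import Data.Nat.Properties hiding (_≟_)
open import Data.Nat.Tactic.RingSolver using (solve-∀)
open import Data.Product.Base using (Σ-syntax)
open import Data.Sum.Base using (inj₁; inj₂)
open import Data.Unit.Base using (tt)
open import Data.Vec.Functional as Vector using (Vector)
open import Function.Base using (_∘_; const; id)
open import Relation.Binary.PropositionalEquality
  using (_≢_; refl; sym; trans; cong; cong₂; subst; module ≡-Reasoning)
open import Relation.Nullary.Decidable using (decidable-stable)

-- Finite sums and double counting in ℕ

private
  variable
    a b p r s : Level
    A : Set a
    B : Set b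
    P : Set p
    Q : Set s
    k : ℕ

∑ : List A → (A → ℕ) → ℕ
∑ xs φ = sum (map φ xs)

infix 5 ∑-syntax
∑-syntax : List A → (A → ℕ) → ℕ
∑-syntax = ∑
syntax ∑-syntax xs (λ x → e) = ∑[ x ← xs ] e

∑-cong : (xs : List A) {φ ψ : A → ℕ} → (∀ x → φ x ≡ ψ x) → ∑ xs φ ≡ ∑ xs ψ
∑-cong []       φ≗ψ = refl
∑-cong (x ∷ xs) φ≗ψ = cong₂ _+_ (φ≗ψ x) (∑-cong xs φ≗ψ)

∑-mono : (xs : List A) {φ ψ : A → ℕ} → (∀ x → φ x ≤ ψ x) → ∑ xs φ ≤ ∑ xs ψ
∑-mono []       φ≤ψ = z≤n
∑-mono (x ∷ xs) φ≤ψ = +-mono-≤ (φ≤ψ x) (∑-mono xs φ≤ψ)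

∑-const : (xs : List A) (m : ℕ) → ∑ xs (const m) ≡ length xs * m
∑-const []       m = refl
∑-const (_ ∷ xs) m = cong (m +_) (∑-const xs m)

∑-+ : (xs : List A) (φ ψ : A → ℕ) → (∑[ x ← xs ] (φ x + ψ x)) ≡ ∑ xs φ + ∑ xs ψ
∑-+ []       φ ψ = refl
∑-+ (x ∷ xs) φ ψ = trans (cong (φ x + ψ x +_) (∑-+ xs φ ψ))
  (lemma (φ x) (ψ x) (∑ xs φ) (∑ xs ψ))
  where
  lemma : ∀ a b c d → a + b + (c + d) ≡ a + c + (b + d)
  lemma = solve-∀

∑-*ˡ : (xs : List A) (m : ℕ) (φ : A → ℕ) → (∑[ x ← xs ] m * φ x) ≡ m * ∑ xs φ
∑-*ˡ []       m φ = sym (*-zeroʳ m)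
∑-*ˡ (x ∷ xs) m φ = trans (cong (m * φ x +_) (∑-*ˡ xs m φ)) (sym (*-distribˡ-+ m (φ x) (∑ xs φ)))

∑-*ʳ : (xs : List A) (m : ℕ) (φ : A → ℕ) → (∑[ x ← xs ] φ x * m) ≡ ∑ xs φ * m
∑-*ʳ xs m φ = trans (∑-cong xs λ x → *-comm (φ x) m) (trans (∑-*ˡ xs m φ) (*-comm m _))

∑-swap : (xs : List A) (ys : List B) (φ : A → B → ℕ) →
         (∑[ x ← xs ] ∑[ y ← ys ] φ x y) ≡ (∑[ y ← ys ] ∑[ x ← xs ] φ x y)
∑-swap []       ys φ = sym (trans (∑-const ys 0) (*-zeroʳ (length ys)))
∑-swap (x ∷ xs) ys φ = trans (cong (∑ ys (φ x) +_) (∑-swap xs ys φ))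
  (sym (∑-+ ys (φ x) λ y → ∑[ x′ ← xs ] φ x′ y))

∑-* : (xs : List A) (ys : List B) (φ : A → ℕ) (ψ : B → ℕ) →
      ∑ xs φ * ∑ ys ψ ≡ (∑[ x ← xs ] ∑[ y ← ys ] φ x * ψ y)
∑-* xs ys φ ψ = trans (sym (∑-*ʳ xs _ φ)) (∑-cong xs λ x → sym (∑-*ˡ ys (φ x) ψ))

∑-++ : (xs ys : List A) (φ : A → ℕ) → ∑ (xs ++ ys) φ ≡ ∑ xs φ + ∑ ys φ
∑-++ []       ys φ = refl
∑-++ (x ∷ xs) ys φ = trans (cong (φ x +_) (∑-++ xs ys φ)) (sym (+-assoc (φ x) _ _))

∑-map : (h : A → B) (xs : List A) (φ : B → ℕ) → ∑ (map h xs) φ ≡ ∑ xs (φ ∘ h)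
∑-map h []       φ = refl
∑-map h (x ∷ xs) φ = cong (φ (h x) +_) (∑-map h xs φ)

∑-cartesianProductWith : ∀ {c} {C : Set c} (h : A → B → C) (xs : List A) (ys : List B) (φ : C → ℕ) →
  ∑ (cartesianProductWith h xs ys) φ ≡ (∑[ x ← xs ] ∑[ y ← ys ] φ (h x y))
∑-cartesianProductWith h []       ys φ = refl
∑-cartesianProductWith h (x ∷ xs) ys φ = trans
  (∑-++ (map (h x) ys) (cartesianProductWith h xs ys) φ)
  (cong₂ _+_ (∑-map (h x) ys φ) (∑-cartesianProductWith h xs ys φ))

infix 8 _²
_² : ℕ → ℕ
m ² = m * m

-- Stating the square of a difference additively avoids truncated subtraction; raising both `m` and
-- `n` by one adds the same amount to each side.
∣-∣² : ∀ m n → ∣ m - n ∣ ² + 2 * (m * n) ≡ m ² + n ²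
∣-∣² zero    n       = +-identityʳ (n * n)
∣-∣² (suc m) zero    = cong (suc m * suc m +_) (cong (2 *_) (*-zeroʳ m))
∣-∣² (suc m) (suc n) = begin
  ∣ m - n ∣ ² + 2 * (suc m * suc n)                ≡⟨ lemma₁ (∣ m - n ∣ ²) m n ⟩
  ∣ m - n ∣ ² + 2 * (m * n) + (2 + 2 * m + 2 * n)  ≡⟨ cong (_+ (2 + 2 * m + 2 * n)) (∣-∣² m n) ⟩
  m ² + n ² + (2 + 2 * m + 2 * n)                  ≡⟨ lemma₂ m n ⟩
  suc m ² + suc n ²                                ∎
  where
  open ≡-Reasoning
  lemma₁ : ∀ d m n → d + 2 * (suc m * suc n) ≡ d + 2 * (m * n) + (2 + 2 * m + 2 * n)
  lemma₁ = solve-∀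
  lemma₂ : ∀ m n → m * m + n * n + (2 + 2 * m + 2 * n) ≡ suc m * suc m + suc n * suc n
  lemma₂ = solve-∀

-- Induction on the list: the cross terms with the new entry are absorbed by 2ab ≤ a² + b², which
-- `∣-∣²` provides.
cauchy-schwarz : (xs : List A) (φ : A → ℕ) → ∑ xs φ ² ≤ length xs * (∑[ x ← xs ] φ x ²)
cauchy-schwarz []       φ = z≤n
cauchy-schwarz (x ∷ xs) φ = begin
  (m + S) ²                                 ≡⟨ lemma₁ m S ⟩
  m ² + (2 * m * S + S ²)                   ≤⟨ +-monoʳ-≤ (m ²) (+-mono-≤ cross (cauchy-schwarz xs φ)) ⟩
  m ² + (length xs * m ² + T + length xs * T) ≡⟨ lemma₂ (m ²) (length xs) T ⟩
  suc (length xs) * (m ² + T)               ∎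
  where
  open ≤-Reasoning
  m = φ x
  S = ∑ xs φ
  T = ∑[ y ← xs ] φ y ²
  cross : 2 * m * S ≤ length xs * m ² + T
  cross = begin
    2 * m * S                           ≡⟨ ∑-*ˡ xs (2 * m) φ ⟨
    (∑[ y ← xs ] 2 * m * φ y)           ≤⟨ ∑-mono xs (λ y → subst (_≤ m ² + φ y ²) (sym (*-assoc 2 m (φ y)))
                                             (m+n≤o⇒n≤o (∣ m - φ y ∣ ²) (≤-reflexive (∣-∣² m (φ y))))) ⟩
    (∑[ y ← xs ] (m ² + φ y ²))         ≡⟨ ∑-+ xs (λ _ → m ²) (λ y → φ y ²) ⟩
    (∑[ _ ← xs ] m ²) + T               ≡⟨ cong (_+ T) (∑-const xs (m ²)) ⟩
    length xs * m ² + T                 ∎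
  lemma₁ : ∀ a S → (a + S) * (a + S) ≡ a * a + (2 * a * S + S * S)
  lemma₁ = solve-∀
  lemma₂ : ∀ c l t → c + (l * c + t + l * t) ≡ (1 + l) * (c + t)
  lemma₂ = solve-∀

∣∑-∑∣ : (xs : List A) (φ ψ : A → ℕ) → ∣ ∑ xs φ - ∑ xs ψ ∣ ≤ (∑[ x ← xs ] ∣ φ x - ψ x ∣)
∣∑-∑∣ []       φ ψ = z≤n
∣∑-∑∣ (x ∷ xs) φ ψ = begin
  ∣ φ x + ∑ xs φ - ψ x + ∑ xs ψ ∣
    ≤⟨ ∣-∣-triangle (φ x + ∑ xs φ) (ψ x + ∑ xs φ) (ψ x + ∑ xs ψ) ⟩
  ∣ φ x + ∑ xs φ - ψ x + ∑ xs φ ∣ + ∣ ψ x + ∑ xs φ - ψ x + ∑ xs ψ ∣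
    ≡⟨ cong₂ _+_ (cong₂ ∣_-_∣ (+-comm (φ x) _) (+-comm (ψ x) _)) refl ⟩
  ∣ ∑ xs φ + φ x - ∑ xs φ + ψ x ∣ + ∣ ψ x + ∑ xs φ - ψ x + ∑ xs ψ ∣
    ≡⟨ cong₂ _+_ (∣m+n-m+o∣≡∣n-o∣ (∑ xs φ) (φ x) (ψ x)) (∣m+n-m+o∣≡∣n-o∣ (ψ x) (∑ xs φ) (∑ xs ψ)) ⟩
  ∣ φ x - ψ x ∣ + ∣ ∑ xs φ - ∑ xs ψ ∣
    ≤⟨ +-monoʳ-≤ ∣ φ x - ψ x ∣ (∣∑-∑∣ xs φ ψ) ⟩
  ∣ φ x - ψ x ∣ + (∑[ y ← xs ] ∣ φ y - ψ y ∣) ∎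
  where open ≤-Reasoning

-- The expansion of a variance about `m / c` with denominators cleared. It serves the incidences,
-- then `ν`, then `f`.
∑∣-∣² : (xs : List A) (c m : ℕ) (φ : A → ℕ) →
        (∑[ x ← xs ] ∣ c * φ x - m ∣ ²) + 2 * c * m * ∑ xs φ ≡
        c ² * (∑[ x ← xs ] φ x ²) + length xs * m ²
∑∣-∣² xs c m φ = begin
  (∑[ x ← xs ] ∣ c * φ x - m ∣ ²) + 2 * c * m * ∑ xs φ
    ≡⟨ cong ((∑[ x ← xs ] ∣ c * φ x - m ∣ ²) +_) (∑-*ˡ xs (2 * c * m) φ) ⟨
  (∑[ x ← xs ] ∣ c * φ x - m ∣ ²) + (∑[ x ← xs ] 2 * c * m * φ x)
    ≡⟨ ∑-+ xs (λ x → ∣ c * φ x - m ∣ ²) (λ x → 2 * c * m * φ x) ⟨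
  (∑[ x ← xs ] (∣ c * φ x - m ∣ ² + 2 * c * m * φ x))
    ≡⟨ ∑-cong xs (λ x → trans (cong (∣ c * φ x - m ∣ ² +_) (lemma₁ c m (φ x)))
         (trans (∣-∣² (c * φ x) m) (cong (_+ m ²) (lemma₂ c (φ x))))) ⟩
  (∑[ x ← xs ] (c ² * φ x ² + m ²))
    ≡⟨ ∑-+ xs (λ x → c ² * φ x ²) (λ _ → m ²) ⟩
  (∑[ x ← xs ] c ² * φ x ²) + (∑[ _ ← xs ] m ²)
    ≡⟨ cong₂ _+_ (∑-*ˡ xs (c ²) (λ x → φ x ²)) (∑-const xs (m ²)) ⟩
  c ² * (∑[ x ← xs ] φ x ²) + length xs * m ² ∎
  where
  open ≡-Reasoning
  lemma₁ : ∀ c m f → 2 * c * m * f ≡ 2 * (c * f * m)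
  lemma₁ = solve-∀
  lemma₂ : ∀ c f → (c * f) * (c * f) ≡ c * c * (f * f)
  lemma₂ = solve-∀

𝟙 : Dec P → ℕ
𝟙 P? = if does P? then 1 else 0

𝟙-yes : (P? : Dec P) → P → 𝟙 P? ≡ 1
𝟙-yes (yes _) _ = refl
𝟙-yes (no ¬p) p = contradiction p ¬p

𝟙-no : (P? : Dec P) → ¬ P → 𝟙 P? ≡ 0
𝟙-no (yes p) ¬p = contradiction p ¬p
𝟙-no (no _)  _  = refl

𝟙≤1 : (P? : Dec P) → 𝟙 P? ≤ 1
𝟙≤1 (yes _) = ≤-refl
𝟙≤1 (no _)  = z≤n

𝟙-≤ : (P? : Dec P) {m : ℕ} → (P → 1 ≤ m) → 𝟙 P? ≤ m
𝟙-≤ (yes p) 1≤m = 1≤m p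
𝟙-≤ (no _)  _   = z≤n

𝟙-mono : (P? : Dec P) (Q? : Dec Q) → (P → Q) → 𝟙 P? ≤ 𝟙 Q?
𝟙-mono P? Q? P⇒Q = 𝟙-≤ P? λ p → ≤-reflexive (sym (𝟙-yes Q? (P⇒Q p)))

𝟙-*-≤ : (P? : Dec P) {m n : ℕ} → (P → m ≤ n) → 𝟙 P? * m ≤ n
𝟙-*-≤ (yes p) m≤n = ≤-trans (≤-reflexive (+-identityʳ _)) (m≤n p)
𝟙-*-≤ (no _)  _   = z≤n

∑≤1 : {P : A → Set p} {_≈_ : A → A → Set r} (P? : ∀ x → Dec (P x)) → (∀ {x y} → P x → P y → x ≈ y) →
      ∀ {xs} → AllPairs (λ x y → ¬ x ≈ y) xs → (∑[ x ← xs ] 𝟙 (P? x)) ≤ 1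
∑≤1 {p = p} {r} {P = P} {_≈_} P? P-unique = go
  where
  vanish : ∀ {x xs} → P x → All (λ y → ¬ x ≈ y) xs → (∑[ y ← xs ] 𝟙 (P? y)) ≡ 0
  vanish px []                    = refl
  vanish px (_∷_ {y} x≉y x∉xs) = cong₂ _+_ (𝟙-no (P? y) λ py → x≉y (P-unique px py)) (vanish px x∉xs)
  go : ∀ {xs} → AllPairs (λ x y → ¬ x ≈ y) xs → (∑[ x ← xs ] 𝟙 (P? x)) ≤ 1
  go []                 = z≤n
  go (_∷_ {x} x∉xs xs!) with P? x
  ... | yes px = ≤-reflexive (cong suc (vanish px x∉xs))
  ... | no  _  = go xs!

1≤∑ : {φ : A → ℕ} → ∀ {xs} → Any (λ x → 1 ≤ φ x) xs → 1 ≤ ∑ xs φ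
1≤∑         (here px)   = ≤-trans px (m≤m+n _ _)
1≤∑ {φ = φ} (there pxs) = ≤-trans (1≤∑ {φ = φ} pxs) (m≤n+m _ _)

1≤∑𝟙 : {P : A → Set p} (P? : ∀ x → Dec (P x)) → ∀ {xs} → Any P xs → 1 ≤ (∑[ x ← xs ] 𝟙 (P? x))
1≤∑𝟙 P? = 1≤∑ ∘ Any.map λ {x} px → ≤-reflexive (sym (𝟙-yes (P? x) px))

-- Double counting of the pairs related by `R`: each counted `x` has a partner, and no `y` is the
-- partner of two inequivalent `x`. A relation in place of a function spares choosing partners.
count-≤ : ∀ {q} {P : A → Set p} {Q : B → Set q} {R : A → B → Set r} {_≈_ : A → A → Set s}
          (P? : ∀ x → Dec (P x)) (Q? : ∀ y → Dec (Q y)) (R? : ∀ x y → Dec (R x y)) →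
          {xs : List A} {ys : List B} → AllPairs (λ x y → ¬ x ≈ y) xs →
          (∀ {x} → P x → Any (λ y → Q y × R x y) ys) →
          (∀ {x x′ y} → P x → P x′ → R x y → R x′ y → x ≈ x′) →
          (∑[ x ← xs ] 𝟙 (P? x)) ≤ (∑[ y ← ys ] 𝟙 (Q? y))
count-≤ {_≈_ = _≈_} P? Q? R? {xs} {ys} xs! total injective = begin
  (∑[ x ← xs ] 𝟙 (P? x))
    ≤⟨ ∑-mono xs (λ x → 𝟙-≤ (P? x) λ px → 1≤∑𝟙 (λ y → P? x ×-dec Q? y ×-dec R? x y)
         (Any.map (λ (qy , rxy) → px , qy , rxy) (total px))) ⟩
  (∑[ x ← xs ] ∑[ y ← ys ] 𝟙 (P? x ×-dec Q? y ×-dec R? x y))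
    ≡⟨ ∑-swap xs ys _ ⟩
  (∑[ y ← ys ] ∑[ x ← xs ] 𝟙 (P? x ×-dec Q? y ×-dec R? x y))
    ≤⟨ ∑-mono ys (λ y → fibre y (Q? y)) ⟩
  (∑[ y ← ys ] 𝟙 (Q? y)) ∎
  where
  open ≤-Reasoning
  fibre : ∀ y (q? : Dec _) → (∑[ x ← xs ] 𝟙 (P? x ×-dec q? ×-dec R? x y)) ≤ 𝟙 q?
  fibre y (yes q) = ∑≤1 {_≈_ = _≈_} (λ x → P? x ×-dec yes q ×-dec R? x y) (λ (px , _ , rxy) (px′ , _ , rx′y) → injective px px′ rxy rx′y) xs!
  fibre y (no ¬q) = ≤-trans (∑-mono xs (λ x → ≤-reflexive (𝟙-no (P? x ×-dec no ¬q ×-dec R? x y) (¬q ∘ proj₁ ∘ proj₂))))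
    (≤-reflexive (trans (∑-const xs 0) (*-zeroʳ (length xs))))

length-≤ : {R : A → B → Set r} {_≈_ : A → A → Set s} (R? : ∀ x y → Dec (R x y)) →
           {xs : List A} {ys : List B} → AllPairs (λ x y → ¬ x ≈ y) xs →
           (∀ x → Any (R x) ys) → (∀ {x x′ y} → R x y → R x′ y → x ≈ x′) → length xs ≤ length ys
length-≤ R? {xs} {ys} xs! total injective = begin
  length xs                 ≡⟨ *-identityʳ _ ⟨
  length xs * 1             ≡⟨ ∑-const xs 1 ⟨
  (∑[ _ ← xs ] 1)           ≤⟨ ∑-mono xs (λ x → 1≤∑𝟙 (R? x) (total x)) ⟩
  (∑[ x ← xs ] ∑[ y ← ys ] 𝟙 (R? x y)) ≡⟨ ∑-swap xs ys _ ⟩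
  (∑[ y ← ys ] ∑[ x ← xs ] 𝟙 (R? x y)) ≤⟨ ∑-mono ys (λ y → ∑≤1 (λ x → R? x y) injective xs!) ⟩
  (∑[ _ ← ys ] 1)           ≡⟨ ∑-const ys 1 ⟩
  length ys * 1             ≡⟨ *-identityʳ _ ⟩
  length ys                 ∎
  where open ≤-Reasoning

length-cartesianProductWith : ∀ {c} {C : Set c} (h : A → B → C) (xs : List A) (ys : List B) →
                              length (cartesianProductWith h xs ys) ≡ length xs * length ys
length-cartesianProductWith h []       ys = refl
length-cartesianProductWith h (x ∷ xs) ys = trans (length-++ (map (h x) ys))
  (cong₂ _+_ (length-map (h x) ys) (length-cartesianProductWith h xs ys))

length-nonZero : {P : A → Set p} {xs : List A} → Any P xs → NonZero (length xs)
length-nonZero (here _)  = _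
length-nonZero (there _) = _

count-≤-length : {P : A → Set p} {R : A → B → Set r} {_≈_ : A → A → Set s}
                 (P? : ∀ x → Dec (P x)) (R? : ∀ x y → Dec (R x y)) →
                 {xs : List A} {ys : List B} → AllPairs (λ x y → ¬ x ≈ y) xs →
                 (∀ {x} → P x → Any (R x) ys) →
                 (∀ {x x′ y} → P x → P x′ → R x y → R x′ y → x ≈ x′) →
                 (∑[ x ← xs ] 𝟙 (P? x)) ≤ length ys
count-≤-length {_≈_ = _≈_} P? R? {xs} {ys} xs! total injective = begin
  (∑[ x ← xs ] 𝟙 (P? x)) ≤⟨ count-≤ {_≈_ = _≈_} P? (λ _ → yes tt) R? xs! (Any.map (tt ,_) ∘ total) injective ⟩
  (∑[ _ ← ys ] 1)        ≡⟨ ∑-const ys 1 ⟩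
  length ys * 1          ≡⟨ *-identityʳ _ ⟩
  length ys              ∎
  where open ≤-Reasoning

𝟙-× : (P? : Dec P) (Q? : Dec Q) → 𝟙 (P? ×-dec Q?) ≡ 𝟙 P? * 𝟙 Q?
𝟙-× (yes _) (yes _) = refl
𝟙-× (yes _) (no _)  = refl
𝟙-× (no _)  _       = refl

∑-≤-const : (xs : List A) (m : ℕ) {φ : A → ℕ} → (∀ x → φ x ≤ m) → ∑ xs φ ≤ length xs * m
∑-≤-const xs m φ≤m = ≤-trans (∑-mono xs φ≤m) (≤-reflexive (∑-const xs m))

∑-≥-const : (xs : List A) (m : ℕ) {φ : A → ℕ} → (∀ x → m ≤ φ x) → length xs * m ≤ ∑ xs φ
∑-≥-const xs m m≤φ = ≤-trans (≤-reflexive (sym (∑-const xs m))) (∑-mono xs m≤φ)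

-- Sums over a finite setoid

module Enumeration {a ℓ} (S : FiniteSetoid a ℓ) where
  open FiniteSetoid S using (Carrier; _≈_; _≟_; elements; complete; decSetoid)
  private
    module S = FiniteSetoid S

  list : List Carrier
  list = deduplicate _≟_ elements

  list! : AllPairs (λ x y → ¬ x ≈ y) list
  list! = deduplicate-! decSetoid elements

  list-complete : ∀ x → Any (x ≈_) list
  list-complete = deduplicate⁺ decSetoid complete

  ∑-unique : ∀ {p} {P : Carrier → Set p} (P? : ∀ x → Dec (P x)) →
             (∀ {x y} → P x → P y → x ≈ y) → (∑[ x ← list ] 𝟙 (P? x)) ≤ 1
  ∑-unique P? P-unique = ∑≤1 P? P-unique list!

  ∑-≟ : ∀ x → (∑[ y ← list ] 𝟙 (x ≟ y)) ≡ 1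
  ∑-≟ x = ≤-antisym (∑-unique (x ≟_) λ x≈y x≈z → S.trans (S.sym x≈y) x≈z)
    (1≤∑𝟙 (x ≟_) (list-complete x))

  -- Squaring the size of a fibre of `h` counts the ordered pairs inside it, and two entries share a
  -- fibre for exactly one `t` or for none.
  collisions : (xs : List A) (h : A → Carrier) →
               (∑[ t ← list ] (∑[ x ← xs ] 𝟙 (h x ≟ t)) ²) ≡ (∑[ x ← xs ] ∑[ y ← xs ] 𝟙 (h x ≟ h y))
  collisions xs h = begin
    (∑[ t ← list ] (∑[ x ← xs ] 𝟙 (h x ≟ t)) ²)
      ≡⟨ ∑-cong list (λ t → ∑-* xs xs _ _) ⟩
    (∑[ t ← list ] ∑[ x ← xs ] ∑[ y ← xs ] 𝟙 (h x ≟ t) * 𝟙 (h y ≟ t))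
      ≡⟨ ∑-swap list xs _ ⟩
    (∑[ x ← xs ] ∑[ t ← list ] ∑[ y ← xs ] 𝟙 (h x ≟ t) * 𝟙 (h y ≟ t))
      ≡⟨ ∑-cong xs (λ x → ∑-swap list xs _) ⟩
    (∑[ x ← xs ] ∑[ y ← xs ] ∑[ t ← list ] 𝟙 (h x ≟ t) * 𝟙 (h y ≟ t))
      ≡⟨ ∑-cong xs (λ x → ∑-cong xs λ y → common (h x) (h y)) ⟩
    (∑[ x ← xs ] ∑[ y ← xs ] 𝟙 (h x ≟ h y)) ∎
    where
    open ≡-Reasoning
    common : ∀ u v → (∑[ t ← list ] 𝟙 (u ≟ t) * 𝟙 (v ≟ t)) ≡ 𝟙 (u ≟ v)
    common u v with u ≟ v
    ... | yes u≈v = trans (∑-cong list pointwise) (∑-≟ u)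
      where
      pointwise : ∀ t → 𝟙 (u ≟ t) * 𝟙 (v ≟ t) ≡ 𝟙 (u ≟ t)
      pointwise t with u ≟ t
      ... | yes u≈t = trans (+-identityʳ _) (𝟙-yes (v ≟ t) (S.trans (S.sym u≈v) u≈t))
      ... | no _    = refl
    ... | no u≉v = trans (∑-cong list pointwise) (trans (∑-const list 0) (*-zeroʳ (length list)))
      where
      pointwise : ∀ t → 𝟙 (u ≟ t) * 𝟙 (v ≟ t) ≡ 0
      pointwise t with u ≟ t
      ... | yes u≈t = trans (+-identityʳ _) (𝟙-no (v ≟ t) λ v≈t → u≉v (S.trans u≈t (S.sym v≈t)))
      ... | no _    = refl

-- Incidences with lines and the distribution of areas

module Incidence {c ℓ} (F : FiniteField c ℓ) where
  open PlaneGeometry F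
  open FiniteField F using () renaming (_≟_ to infix 4 _≟_)
  private
    module F = FiniteField F
    module plane = FiniteSetoid plane
    module Fs = Enumeration finiteSetoid
    module Ps = Enumeration plane

  q : ℕ
  q = order

  scalars : List Carrier
  scalars = Fs.list

  points : List Point
  points = Ps.list

  -- Repetitions are removed after forming the product on the left and before it on the right; both
  -- lists enumerate the plane without repetition, so each injects into the other.
  ∣plane∣ : length points ≡ q * q
  ∣plane∣ = trans
    (≤-antisym
      (length-≤ plane._≟_ Ps.list! (cartesianProduct⁺ F.setoid F.setoid Fs.list-complete Fs.list-complete) left)
      (length-≤ plane._≟_ (Unique.cartesianProduct⁺ F.setoid F.setoid Fs.list! Fs.list!) Ps.list-complete left))
    (length-cartesianProductWith _,_ scalars scalars)
    where
    left : ∀ {x y z} → x ≈ₚ z → y ≈ₚ z → x ≈ₚ y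
    left x≈z y≈z = plane.trans x≈z (plane.sym y≈z)

  1≉0′ : ∀ {a} → a ≈ 1# → ¬ a ≈ 0#
  1≉0′ a≈1 a≈0 = 1≉0 (F.trans (F.sym a≈1) a≈0)

  -- With `b` a complement of `a`, a point of the line is determined by its product with `b`, one of
  -- `q` scalars. The map `π` lets the bound apply to the plane and to a subset of it.
  line : (π : A → Point) {xs : List A} → AllPairs (λ x y → ¬ π x ≈ₚ π y) xs →
         ∀ a c → ¬ a ≈ₚ 0ₚ → (∑[ x ← xs ] 𝟙 (a ∧ π x ≟ c)) ≤ q
  line π xs! a c a≉0 = let (b , ab≈1) = complement a a≉0 in
    count-≤-length (λ x → a ∧ π x ≟ c) (λ x t → π x ∧ b ≟ t) xs!
      (λ {x} _ → Fs.list-complete (π x ∧ b))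
      (λ ax≈c ax′≈c xb≈t x′b≈t →
        ∧-separates (1≉0′ ab≈1) (F.trans ax≈c (F.sym ax′≈c)) (F.trans xb≈t (F.sym x′b≈t)))

  module _ {e} (E : Subset plane e) where
    private
      module Es = Enumeration (subset plane E)

    set : List (∃ (Subset.member E))
    set = Es.list

    N : ℕ
    N = length set

    set! : AllPairs (λ x y → ¬ proj₁ x ≈ₚ proj₁ y) set
    set! = Es.list!

    incidences : Point → Carrier → ℕ
    incidences x t = ∑[ y ← set ] 𝟙 (x ∧ proj₁ y ≟ t)

    ∑-incidences : ∀ x → ∑ scalars (incidences x) ≡ N
    ∑-incidences x = begin
      (∑[ t ← scalars ] ∑[ y ← set ] 𝟙 (x ∧ proj₁ y ≟ t)) ≡⟨ ∑-swap scalars set _ ⟩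
      (∑[ y ← set ] ∑[ t ← scalars ] 𝟙 (x ∧ proj₁ y ≟ t)) ≡⟨ ∑-cong set (λ y → Fs.∑-≟ (x ∧ proj₁ y)) ⟩
      (∑[ y ← set ] 1)                                      ≡⟨ ∑-const set 1 ⟩
      N * 1                                                 ≡⟨ *-identityʳ N ⟩
      N                                                     ∎
      where open ≡-Reasoning

    -- For `y` and `z` distinct, `x` lies on the line through the origin in the direction `y -ₚ z`.
    -- The spare `q` on the diagonal makes the bound uniform over pairs.
    equal-products : ∀ y z (y≟z : Dec (y ≈ₚ z)) → (∑[ x ← points ] 𝟙 (x ∧ y ≟ x ∧ z)) ≤ q * q * 𝟙 y≟z + q
    equal-products y z (yes _) = begin
      (∑[ x ← points ] 𝟙 (x ∧ y ≟ x ∧ z)) ≤⟨ ∑-≤-const points 1 (λ x → 𝟙≤1 (x ∧ y ≟ x ∧ z)) ⟩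
      length points * 1                   ≡⟨ cong (_* 1) ∣plane∣ ⟩
      q * q * 1                           ≤⟨ m≤m+n _ q ⟩
      q * q * 1 + q                       ∎
      where open ≤-Reasoning
    equal-products y z (no y≉z) = begin
      (∑[ x ← points ] 𝟙 (x ∧ y ≟ x ∧ z))
        ≤⟨ ∑-mono points (λ x → 𝟙-mono (x ∧ y ≟ x ∧ z) (y -ₚ z ∧ x ≟ 0#) (∧-difference x y z)) ⟩
      (∑[ x ← points ] 𝟙 (y -ₚ z ∧ x ≟ 0#))
        ≤⟨ line (λ x → x) Ps.list! (y -ₚ z) 0# (y≉z ∘ -ₚ≈0) ⟩
      q
        ≤⟨ m≤n+m q (q * q * 0) ⟩
      q * q * 0 + q ∎
      where open ≤-Reasoning

    incidences-² : (∑[ x ← points ] ∑[ t ← scalars ] incidences x t ²) ≤ q * q * N + N * N * q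
    incidences-² = begin
      (∑[ x ← points ] ∑[ t ← scalars ] incidences x t ²)
        ≡⟨ ∑-cong points (λ x → Fs.collisions set (λ y → x ∧ proj₁ y)) ⟩
      (∑[ x ← points ] ∑[ y ← set ] ∑[ z ← set ] 𝟙 (x ∧ proj₁ y ≟ x ∧ proj₁ z))
        ≡⟨ ∑-swap points set _ ⟩
      (∑[ y ← set ] ∑[ x ← points ] ∑[ z ← set ] 𝟙 (x ∧ proj₁ y ≟ x ∧ proj₁ z))
        ≡⟨ ∑-cong set (λ y → ∑-swap points set _) ⟩
      (∑[ y ← set ] ∑[ z ← set ] ∑[ x ← points ] 𝟙 (x ∧ proj₁ y ≟ x ∧ proj₁ z))
        ≤⟨ ∑-mono set (λ y → ∑-mono set λ z → equal-products (proj₁ y) (proj₁ z) (proj₁ y plane.≟ proj₁ z)) ⟩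
      (∑[ y ← set ] ∑[ z ← set ] (q * q * 𝟙 (proj₁ y plane.≟ proj₁ z) + q))
        ≡⟨ ∑-cong set (λ y → trans (∑-+ set _ _) (cong₂ _+_
             (trans (∑-*ˡ set (q * q) _) (trans (cong (q * q *_) (Es.∑-≟ y)) (*-identityʳ (q * q))))
             (∑-const set q))) ⟩
      (∑[ y ← set ] (q * q + N * q))
        ≡⟨ ∑-const set _ ⟩
      N * (q * q + N * q)
        ≡⟨ lemma N q ⟩
      q * q * N + N * N * q ∎
      where
      open ≤-Reasoning
      lemma : ∀ N q → N * (q * q + N * q) ≡ q * q * N + N * N * q
      lemma = solve-∀

    discrepancy : Point → ℕ
    discrepancy x = ∑[ t ← scalars ] ∣ q * incidences x t - N ∣ ²

    -- The off-diagonal part of `incidences-²` and the squared means contribute `q ^ 3 * N ²` each,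
    -- together exactly the cross term. Only the diagonal `q ² * (q * q * N)` is left.
    ∑-discrepancy : ∑ points discrepancy ≤ q ^ 4 * N
    ∑-discrepancy = +-cancelʳ-≤ (q * q * (2 * q * N * N)) _ _ (begin
      ∑ points discrepancy + q * q * (2 * q * N * N)
        ≡⟨ cong (λ l → ∑ points discrepancy + l * (2 * q * N * N)) ∣plane∣ ⟨
      ∑ points discrepancy + length points * (2 * q * N * N)
        ≡⟨ cong (∑ points discrepancy +_) (∑-const points _) ⟨
      ∑ points discrepancy + (∑[ x ← points ] 2 * q * N * N)
        ≡⟨ ∑-+ points _ _ ⟨
      (∑[ x ← points ] (discrepancy x + 2 * q * N * N))
        ≡⟨ ∑-cong points (λ x → trans (cong (λ s → discrepancy x + 2 * q * N * s) (sym (∑-incidences x)))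
             (∑∣-∣² scalars q N (incidences x))) ⟩
      (∑[ x ← points ] (q ² * (∑[ t ← scalars ] incidences x t ²) + q * N ²))
        ≡⟨ ∑-+ points _ _ ⟩
      (∑[ x ← points ] q ² * (∑[ t ← scalars ] incidences x t ²)) + (∑[ x ← points ] q * N ²)
        ≡⟨ cong₂ _+_ (∑-*ˡ points (q ²) _) (trans (∑-const points _) (cong (_* (q * N ²)) ∣plane∣)) ⟩
      q ² * (∑[ x ← points ] ∑[ t ← scalars ] incidences x t ²) + q * q * (q * N ²)
        ≤⟨ +-monoˡ-≤ _ (*-monoʳ-≤ (q ²) incidences-²) ⟩
      q ² * (q * q * N + N * N * q) + q * q * (q * N ²)
        ≡⟨ lemma q N ⟩
      q ^ 4 * N + q * q * (2 * q * N * N) ∎)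
      where
      open ≤-Reasoning
      lemma : ∀ q N → q * q * (q * q * N + N * N * q) + q * q * (q * (N * N)) ≡
                      q * (q * (q * (q * 1))) * N + q * q * (2 * q * N * N)
      lemma = solve-∀

    discrepancy-cong : ∀ {x y} → x ≈ₚ y → discrepancy x ≡ discrepancy y
    discrepancy-cong {x} {y} x≈y = ∑-cong scalars λ t → cong (λ i → ∣ q * i - N ∣ ²)
      (∑-cong set λ z → ≤-antisym
        (𝟙-mono (x ∧ proj₁ z ≟ t) (y ∧ proj₁ z ≟ t) (F.trans (∧-cong (plane.sym x≈y) plane.refl)))
        (𝟙-mono (y ∧ proj₁ z ≟ t) (x ∧ proj₁ z ≟ t) (F.trans (∧-cong x≈y plane.refl))))

    -- Each member of `E` equals exactly one listed point of the plane, and each point equals at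
    -- most one listed member.
    ∑-set-≤ : (φ : Point → ℕ) → (∀ {x y} → x ≈ₚ y → φ x ≡ φ y) → (∑[ x ← set ] φ (proj₁ x)) ≤ ∑ points φ
    ∑-set-≤ φ φ-cong = begin
      (∑[ x ← set ] φ (proj₁ x))
        ≡⟨ ∑-cong set (λ x → trans (sym (*-identityˡ _)) (cong (_* φ (proj₁ x)) (sym (Ps.∑-≟ (proj₁ x))))) ⟩
      (∑[ x ← set ] (∑[ y ← points ] 𝟙 (proj₁ x plane.≟ y)) * φ (proj₁ x))
        ≡⟨ ∑-cong set (λ x → ∑-*ʳ points (φ (proj₁ x)) _) ⟨
      (∑[ x ← set ] ∑[ y ← points ] 𝟙 (proj₁ x plane.≟ y) * φ (proj₁ x))
        ≤⟨ ∑-mono set (λ x → ∑-mono points λ y → exchange x y) ⟩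
      (∑[ x ← set ] ∑[ y ← points ] 𝟙 (proj₁ x plane.≟ y) * φ y)
        ≡⟨ ∑-swap set points _ ⟩
      (∑[ y ← points ] ∑[ x ← set ] 𝟙 (proj₁ x plane.≟ y) * φ y)
        ≡⟨ ∑-cong points (λ y → ∑-*ʳ set (φ y) _) ⟩
      (∑[ y ← points ] (∑[ x ← set ] 𝟙 (proj₁ x plane.≟ y)) * φ y)
        ≤⟨ ∑-mono points (λ y → *-monoˡ-≤ (φ y) (Es.∑-unique (λ x → proj₁ x plane.≟ y)
             λ x≈y z≈y → plane.trans x≈y (plane.sym z≈y))) ⟩
      (∑[ y ← points ] 1 * φ y)
        ≡⟨ ∑-cong points (λ y → *-identityˡ (φ y)) ⟩
      ∑ points φ ∎
      where
      open ≤-Reasoning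
      exchange : ∀ x y → 𝟙 (proj₁ x plane.≟ y) * φ (proj₁ x) ≤ 𝟙 (proj₁ x plane.≟ y) * φ y
      exchange x y = 𝟙-*-≤ (proj₁ x plane.≟ y) λ x≈y → begin
        φ (proj₁ x)                     ≡⟨ φ-cong x≈y ⟩
        φ y                             ≡⟨ *-identityˡ (φ y) ⟨
        1 * φ y                         ≡⟨ cong (_* φ y) (𝟙-yes (proj₁ x plane.≟ y) x≈y) ⟨
        𝟙 (proj₁ x plane.≟ y) * φ y     ∎

    ν : Carrier → ℕ
    ν t = ∑[ x ← set ] incidences (proj₁ x) t

    ∑-ν : ∑ scalars ν ≡ N ²
    ∑-ν = trans (∑-swap scalars set _) (trans (∑-cong set λ x → ∑-incidences (proj₁ x)) (∑-const set N))

    -- Cauchy-Schwarz over the `N` base points bounds the deviation of `ν` by those of single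
    -- points; the base point is then allowed to range over the whole plane, where `∑-discrepancy`
    -- applies.
    ν-discrepancy : (∑[ t ← scalars ] ∣ q * ν t - N ² ∣ ²) ≤ q ^ 4 * N ²
    ν-discrepancy = begin
      (∑[ t ← scalars ] ∣ q * ν t - N ² ∣ ²)
        ≤⟨ ∑-mono scalars pointwise ⟩
      (∑[ t ← scalars ] N * (∑[ x ← set ] ∣ q * incidences (proj₁ x) t - N ∣ ²))
        ≡⟨ ∑-*ˡ scalars N _ ⟩
      N * (∑[ t ← scalars ] ∑[ x ← set ] ∣ q * incidences (proj₁ x) t - N ∣ ²)
        ≡⟨ cong (N *_) (∑-swap scalars set _) ⟩
      N * (∑[ x ← set ] discrepancy (proj₁ x))
        ≤⟨ *-monoʳ-≤ N (≤-trans (∑-set-≤ discrepancy discrepancy-cong) ∑-discrepancy) ⟩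
      N * (q ^ 4 * N)
        ≡⟨ lemma N (q ^ 4) ⟩
      q ^ 4 * N ² ∎
      where
      open ≤-Reasoning
      lemma : ∀ N r → N * (r * N) ≡ r * (N * N)
      lemma = solve-∀
      pointwise : ∀ t → ∣ q * ν t - N ² ∣ ² ≤ N * (∑[ x ← set ] ∣ q * incidences (proj₁ x) t - N ∣ ²)
      pointwise t = ≤-trans (*-mono-≤ triangle triangle) (cauchy-schwarz set _)
        where
        triangle : ∣ q * ν t - N ² ∣ ≤ (∑[ x ← set ] ∣ q * incidences (proj₁ x) t - N ∣)
        triangle = begin
          ∣ q * ν t - N ² ∣
            ≡⟨ cong₂ ∣_-_∣ (∑-*ˡ set q _) (∑-const set N) ⟨
          ∣ (∑[ x ← set ] q * incidences (proj₁ x) t) - ∑ set (const N) ∣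
            ≤⟨ ∣∑-∑∣ set _ _ ⟩
          (∑[ x ← set ] ∣ q * incidences (proj₁ x) t - N ∣) ∎

    -- The common factor `q` stays because nothing here says that `q` is nonzero; `f-dispersion`
    -- cancels it.
    ν-² : q * (q * (∑[ t ← scalars ] ν t ²)) ≤ q * (N ² ² + q ^ 3 * N ²)
    ν-² = +-cancelʳ-≤ (q * N ² ²) _ _ (begin
      q * (q * (∑[ t ← scalars ] ν t ²)) + q * N ² ²
        ≡⟨ cong (_+ q * N ² ²) (*-assoc q q _) ⟨
      q ² * (∑[ t ← scalars ] ν t ²) + q * N ² ²
        ≡⟨ ∑∣-∣² scalars q (N ²) ν ⟨
      (∑[ t ← scalars ] ∣ q * ν t - N ² ∣ ²) + 2 * q * N ² * ∑ scalars ν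
        ≡⟨ cong (λ s → (∑[ t ← scalars ] ∣ q * ν t - N ² ∣ ²) + 2 * q * N ² * s) ∑-ν ⟩
      (∑[ t ← scalars ] ∣ q * ν t - N ² ∣ ²) + 2 * q * N ² * N ²
        ≤⟨ +-monoˡ-≤ _ ν-discrepancy ⟩
      q ^ 4 * N ² + 2 * q * N ² * N ²
        ≡⟨ lemma q (N ²) ⟩
      q * (N ² ² + q ^ 3 * N ²) + q * N ² ² ∎)
      where
      open ≤-Reasoning
      lemma : ∀ q m → q * (q * (q * (q * 1))) * m + 2 * q * m * m ≡ q * (m * m + q * (q * (q * 1)) * m) + q * (m * m)
      lemma = solve-∀

-- Transporters in SL₂ and the dispersion of `f`

module SpecialLinear {c ℓ} (F : FiniteField c ℓ) where
  open PlaneGeometry F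
  open Incidence F
  open FiniteField F using () renaming (_≟_ to infix 4 _≟_)
  private
    module F = FiniteField F
    module plane = FiniteSetoid plane
    module Fs = Enumeration finiteSetoid
    module Ps = Enumeration plane

  SL₂ : Subset (plane ×ᶠ plane) ℓ
  SL₂ = record
    { member   = λ (u , v) → u ∧ v ≈ 1#
    ; member?  = λ (u , v) → u ∧ v ≟ 1#
    ; respects = λ (u≈u′ , v≈v′) uv≈1 → F.trans (F.sym (∧-cong u≈u′ v≈v′)) uv≈1
    }

  private
    module Gs = Enumeration (subset (plane ×ᶠ plane) SL₂)

  Matrix : Set _
  Matrix = ∃ (Subset.member SL₂)

  matrices : List Matrix
  matrices = Gs.list

  infixr 8 _$_
  _$_ : Matrix → Point → Point
  (g , _) $ x = g ∙ x

  infix 4 _≟ₚ_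
  _≟ₚ_ : (x y : Point) → Dec (x ≈ₚ y)
  _≟ₚ_ = plane._≟_

  $-∧ : ∀ g x y → (g $ x) ∧ (g $ y) ≈ x ∧ y
  $-∧ (g , uv≈1) x y = F.trans (∧-∙ g x y) (F.trans (F.*-congʳ uv≈1) (F.*-identityˡ _))

  $-≉0 : ∀ g {x} → ¬ x ≈ₚ 0ₚ → ¬ g $ x ≈ₚ 0ₚ
  $-≉0 g {x} x≉0 = let (y , xy≈1) = complement x x≉0 in ∧≉0⇒≉0 (1≉0′ (F.trans ($-∧ g x y) xy≈1))

  -- The elements of SL₂ taking x to x′ are determined by one coordinate of the image of a complement of x.
  module _ {x x′} (x≉0 : ¬ x ≈ₚ 0ₚ) (x′≉0 : ¬ x′ ≈ₚ 0ₚ) where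
    private
      y = proj₁ (complement x x≉0)
      xy≈1 : x ∧ y ≈ 1#
      xy≈1 = proj₂ (complement x x≉0)
      y′ = proj₁ (complement x′ x′≉0)
      x′y′≈1 : x′ ∧ y′ ≈ 1#
      x′y′≈1 = proj₂ (complement x′ x′≉0)

    transporters-≤ : (∑[ g ← matrices ] 𝟙 (g $ x ≟ₚ x′)) ≤ q
    transporters-≤ = count-≤-length (λ g → g $ x ≟ₚ x′) (λ g t → (g $ y) ∧ y′ ≟ t) Gs.list!
      (λ {g} _ → Fs.list-complete ((g $ y) ∧ y′))
      (λ {g} {h} gx≈x′ hx≈x′ gy≈t hy≈t →
        ∙-injective (1≉0′ xy≈1) (plane.trans gx≈x′ (plane.sym hx≈x′))
          (∧-separates (1≉0′ x′y′≈1) (F.trans (image g gx≈x′) (F.sym (image h hx≈x′)))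
            (F.trans gy≈t (F.sym hy≈t))))
      where
      image : ∀ g → g $ x ≈ₚ x′ → x′ ∧ (g $ y) ≈ x ∧ y
      image g gx≈x′ = F.trans (∧-cong (plane.sym gx≈x′) plane.refl) ($-∧ g x y)

    transporters-≥ : q ≤ (∑[ g ← matrices ] 𝟙 (g $ x ≟ₚ x′))
    transporters-≥ = begin
      q                                     ≡⟨ *-identityʳ q ⟨
      q * 1                                 ≡⟨ ∑-const scalars 1 ⟨
      (∑[ _ ← scalars ] 1)
        ≤⟨ count-≤ {_≈_ = _≈_} (λ _ → yes tt) (λ g → g $ x ≟ₚ x′) (λ t g → (g $ y) ∧ y′ ≟ t) Fs.list!
             (λ {t} _ → total t) (λ _ _ gy≈t gy≈t′ → F.trans (F.sym gy≈t) gy≈t′) ⟩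
      (∑[ g ← matrices ] 𝟙 (g $ x ≟ₚ x′))   ∎
      where
      open ≤-Reasoning
      total : ∀ t → Any (λ g → g $ x ≈ₚ x′ × (g $ y) ∧ y′ ≈ t) matrices
      total t =
        -- The images allowed for `y` are the shears of `y′` along `x′`; the product with `y′`
        -- returns `t`, so different scalars give different matrices.
        let z = t *ₚ x′ +ₚ y′
            (shear₁ , shear₂) = ∧-shear t x′ y′
            (g , uv≈1 , gx≈x′ , gy≈z) = transporter x y x′ z (1≉0′ xy≈1)
              (F.trans xy≈1 (F.sym (F.trans shear₁ x′y′≈1)))
        in Any.map
             (λ {h} g≈h → plane.trans (∙-congʳ x (FiniteSetoid.sym (plane ×ᶠ plane) g≈h)) gx≈x′ ,
               F.trans (∧-cong (plane.trans (∙-congʳ y (FiniteSetoid.sym (plane ×ᶠ plane) g≈h)) gy≈z) plane.refl)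
                 (F.trans shear₂ (F.trans (F.*-congˡ x′y′≈1) (F.*-identityʳ t))))
             (Gs.list-complete (g , uv≈1))

  ∣SL₂∣ : length matrices ≤ q ^ 3
  ∣SL₂∣ = begin
    length matrices
      ≡⟨ *-identityʳ _ ⟨
    length matrices * 1
      ≡⟨ ∑-const matrices 1 ⟨
    (∑[ g ← matrices ] 1)
      ≡⟨ ∑-cong matrices (λ g → Ps.∑-≟ (g $ e₁)) ⟨
    (∑[ g ← matrices ] ∑[ x ← points ] 𝟙 (g $ e₁ ≟ₚ x))
      ≡⟨ ∑-swap matrices points _ ⟩
    (∑[ x ← points ] ∑[ g ← matrices ] 𝟙 (g $ e₁ ≟ₚ x))
      ≤⟨ ∑-≤-const points q (λ x → fibre x (x ≟ₚ 0ₚ)) ⟩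
    length points * q
      ≡⟨ cong (_* q) ∣plane∣ ⟩
    q * q * q
      ≡⟨ lemma q ⟩
    q ^ 3 ∎
    where
    open ≤-Reasoning
    e₁ : Point
    e₁ = 1# , 0#
    e₁≉0 : ¬ e₁ ≈ₚ 0ₚ
    e₁≉0 (1≈0 , _) = 1≉0 1≈0
    fibre : ∀ x → Dec (x ≈ₚ 0ₚ) → (∑[ g ← matrices ] 𝟙 (g $ e₁ ≟ₚ x)) ≤ q
    fibre x (yes x≈0) = begin
      (∑[ g ← matrices ] 𝟙 (g $ e₁ ≟ₚ x)) ≡⟨ ∑-cong matrices (λ g → 𝟙-no (g $ e₁ ≟ₚ x) λ ge≈x →
                                                $-≉0 g e₁≉0 (plane.trans ge≈x x≈0)) ⟩
      (∑[ g ← matrices ] 0)               ≡⟨ ∑-const matrices 0 ⟩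
      length matrices * 0                 ≡⟨ *-zeroʳ (length matrices) ⟩
      0                                   ≤⟨ z≤n ⟩
      q                                   ∎
    fibre x (no x≉0) = transporters-≤ e₁≉0 x≉0
    lemma : ∀ q → q * q * q ≡ q * (q * (q * 1))
    lemma = solve-∀

  module _ {e} (E : Subset plane e) (E≉0 : ∀ {x} → Subset.member E x → ¬ x ≈ₚ 0ₚ) where
    private
      n : ℕ
      n = N E
      Member : Set _
      Member = ∃ (Subset.member E)
      module Es = Enumeration (subset plane E)
      S : List Member
      S = set E

      nonzero : (x : Member) → ¬ proj₁ x ≈ₚ 0ₚ
      nonzero (_ , x∈E) = E≉0 x∈E

    f : Matrix → ℕ
    f g = ∑[ x ← S ] ∑[ y ← S ] 𝟙 (g $ proj₁ x ≟ₚ proj₁ y)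

    images-≤ : ∀ g x → (∑[ y ← S ] 𝟙 (g $ x ≟ₚ proj₁ y)) ≤ 1
    images-≤ g x = Es.∑-unique (λ y → g $ x ≟ₚ proj₁ y) λ gx≈y gx≈z → plane.trans (plane.sym gx≈y) gx≈z

    f≤n : ∀ g → f g ≤ n
    f≤n g = ≤-trans (∑-≤-const S 1 λ x → images-≤ g (proj₁ x)) (≤-reflexive (*-identityʳ n))

    ∑-f : n * (n * q) ≤ ∑ matrices f
    ∑-f = begin
      n * (n * q)
        ≤⟨ ∑-≥-const S (n * q) (λ x → ∑-≥-const S q λ y → transporters-≥ (nonzero x) (nonzero y)) ⟩
      (∑[ x ← S ] ∑[ y ← S ] ∑[ g ← matrices ] 𝟙 (g $ proj₁ x ≟ₚ proj₁ y))
        ≡⟨ ∑-cong S (λ x → ∑-swap S matrices _) ⟩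
      (∑[ x ← S ] ∑[ g ← matrices ] ∑[ y ← S ] 𝟙 (g $ proj₁ x ≟ₚ proj₁ y))
        ≡⟨ ∑-swap S matrices _ ⟩
      ∑ matrices f ∎
      where open ≤-Reasoning

    private
      pairs : Matrix → Member → Member → Member → Member → ℕ
      pairs g x y x′ y′ = 𝟙 (g $ proj₁ x ≟ₚ proj₁ x′) * 𝟙 (g $ proj₁ y ≟ₚ proj₁ y′)

      H : Member → Member → Member → Member → ℕ
      H x y x′ y′ = ∑[ g ← matrices ] pairs g x y x′ y′

    f-² : ∑ matrices (λ g → f g ²) ≡ (∑[ x ← S ] ∑[ y ← S ] ∑[ x′ ← S ] ∑[ y′ ← S ] H x y x′ y′)
    f-² = begin
      (∑[ g ← matrices ] f g ²)
        ≡⟨ ∑-cong matrices (λ g → trans (∑-* S S _ _) (∑-cong S λ x → ∑-cong S λ y → ∑-* S S _ _)) ⟩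
      (∑[ g ← matrices ] ∑[ x ← S ] ∑[ y ← S ] ∑[ x′ ← S ] ∑[ y′ ← S ] pairs g x y x′ y′)
        ≡⟨ ∑-swap matrices S _ ⟩
      (∑[ x ← S ] ∑[ g ← matrices ] ∑[ y ← S ] ∑[ x′ ← S ] ∑[ y′ ← S ] pairs g x y x′ y′)
        ≡⟨ ∑-cong S (λ x → ∑-swap matrices S _) ⟩
      (∑[ x ← S ] ∑[ y ← S ] ∑[ g ← matrices ] ∑[ x′ ← S ] ∑[ y′ ← S ] pairs g x y x′ y′)
        ≡⟨ ∑-cong S (λ x → ∑-cong S λ y → ∑-swap matrices S _) ⟩
      (∑[ x ← S ] ∑[ y ← S ] ∑[ x′ ← S ] ∑[ g ← matrices ] ∑[ y′ ← S ] pairs g x y x′ y′)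
        ≡⟨ ∑-cong S (λ x → ∑-cong S λ y → ∑-cong S λ x′ → ∑-swap matrices S _) ⟩
      (∑[ x ← S ] ∑[ y ← S ] ∑[ x′ ← S ] ∑[ y′ ← S ] H x y x′ y′) ∎
      where open ≡-Reasoning

    -- A matrix is determined by the images of an independent pair, and it preserves the area of
    -- that pair.
    H-independent : ∀ x y x′ y′ → ¬ proj₁ x ∧ proj₁ y ≈ 0# →
                    H x y x′ y′ ≤ 𝟙 (proj₁ x ∧ proj₁ y ≟ proj₁ x′ ∧ proj₁ y′)
    H-independent (x , _) (y , _) (x′ , _) (y′ , _) xy≉0 = bound (x ∧ y ≟ x′ ∧ y′)
      where
      open ≤-Reasoning
      P? : ∀ g → Dec (g $ x ≈ₚ x′ × g $ y ≈ₚ y′)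
      P? g = g $ x ≟ₚ x′ ×-dec g $ y ≟ₚ y′
      bound : (d : Dec (x ∧ y ≈ x′ ∧ y′)) →
              (∑[ g ← matrices ] 𝟙 (g $ x ≟ₚ x′) * 𝟙 (g $ y ≟ₚ y′)) ≤ 𝟙 d
      bound (yes _) = begin
        (∑[ g ← matrices ] 𝟙 (g $ x ≟ₚ x′) * 𝟙 (g $ y ≟ₚ y′))
          ≡⟨ ∑-cong matrices (λ g → 𝟙-× (g $ x ≟ₚ x′) (g $ y ≟ₚ y′)) ⟨
        (∑[ g ← matrices ] 𝟙 (P? g))
          ≤⟨ Gs.∑-unique P? (λ (gx≈x′ , gy≈y′) (hx≈x′ , hy≈y′) → ∙-injective xy≉0
               (plane.trans gx≈x′ (plane.sym hx≈x′)) (plane.trans gy≈y′ (plane.sym hy≈y′))) ⟩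
        1 ∎
      bound (no xy≉x′y′) = begin
        (∑[ g ← matrices ] 𝟙 (g $ x ≟ₚ x′) * 𝟙 (g $ y ≟ₚ y′))
          ≡⟨ ∑-cong matrices (λ g → trans (sym (𝟙-× (g $ x ≟ₚ x′) (g $ y ≟ₚ y′)))
               (𝟙-no (P? g) λ (gx≈x′ , gy≈y′) → xy≉x′y′ (F.trans (F.sym ($-∧ g x y)) (∧-cong gx≈x′ gy≈y′)))) ⟩
        (∑[ g ← matrices ] 0) ≡⟨ ∑-const matrices 0 ⟩
        length matrices * 0   ≡⟨ *-zeroʳ (length matrices) ⟩
        0                     ∎

    -- Valid for dependent pairs too: `x′` is free, at most `q` matrices take `x` to it, and each of
    -- them fixes `y′` in turn.
    ∑∑-H : ∀ x y → (∑[ x′ ← S ] ∑[ y′ ← S ] H x y x′ y′) ≤ n * q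
    ∑∑-H x y = ∑-≤-const S q λ x′ → begin
      (∑[ y′ ← S ] ∑[ g ← matrices ] pairs g x y x′ y′)
        ≡⟨ ∑-swap S matrices _ ⟩
      (∑[ g ← matrices ] ∑[ y′ ← S ] pairs g x y x′ y′)
        ≡⟨ ∑-cong matrices (λ g → ∑-*ˡ S (𝟙 (g $ proj₁ x ≟ₚ proj₁ x′)) _) ⟩
      (∑[ g ← matrices ] 𝟙 (g $ proj₁ x ≟ₚ proj₁ x′) * (∑[ y′ ← S ] 𝟙 (g $ proj₁ y ≟ₚ proj₁ y′)))
        ≤⟨ ∑-mono matrices (λ g → ≤-trans (*-monoʳ-≤ (𝟙 (g $ proj₁ x ≟ₚ proj₁ x′)) (images-≤ g (proj₁ y)))
             (≤-reflexive (*-identityʳ _))) ⟩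
      (∑[ g ← matrices ] 𝟙 (g $ proj₁ x ≟ₚ proj₁ x′))
        ≤⟨ transporters-≤ (nonzero x) (nonzero x′) ⟩
      q ∎
      where open ≤-Reasoning

    ∑-ν² : (∑[ x ← S ] ∑[ y ← S ] ∑[ x′ ← S ] ∑[ y′ ← S ] 𝟙 (proj₁ x ∧ proj₁ y ≟ proj₁ x′ ∧ proj₁ y′)) ≡
           (∑[ t ← scalars ] ν E t ²)
    ∑-ν² = begin
      (∑[ x ← S ] ∑[ y ← S ] ∑[ x′ ← S ] ∑[ y′ ← S ] 𝟙 (area (x , y) ≟ area (x′ , y′)))
        ≡⟨ ∑-cong S (λ x → ∑-cong S λ y → ∑-cartesianProductWith _,_ S S _) ⟨
      (∑[ x ← S ] ∑[ y ← S ] ∑[ r ← cartesianProduct S S ] 𝟙 (area (x , y) ≟ area r))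
        ≡⟨ ∑-cartesianProductWith _,_ S S _ ⟨
      (∑[ p ← cartesianProduct S S ] ∑[ r ← cartesianProduct S S ] 𝟙 (area p ≟ area r))
        ≡⟨ Fs.collisions (cartesianProduct S S) area ⟨
      (∑[ t ← scalars ] (∑[ p ← cartesianProduct S S ] 𝟙 (area p ≟ t)) ²)
        ≡⟨ ∑-cong scalars (λ t → cong _² (∑-cartesianProductWith _,_ S S (λ p → 𝟙 (area p ≟ t)))) ⟩
      (∑[ t ← scalars ] ν E t ²) ∎
      where
      open ≡-Reasoning
      area : Member × Member → Carrier
      area (x , y) = proj₁ x ∧ proj₁ y

    -- Independent pairs contribute at most the collisions of areas. The dependent ones number at
    -- most `n * q`, a line through the origin holding at most `q` points, and each contributes at
    -- most `n * q`.
    f-²-≤ : ∑ matrices (λ g → f g ²) ≤ (∑[ t ← scalars ] ν E t ²) + n * q * (n * q)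
    f-²-≤ = begin
      ∑ matrices (λ g → f g ²)
        ≡⟨ f-² ⟩
      (∑[ x ← S ] ∑[ y ← S ] ∑[ x′ ← S ] ∑[ y′ ← S ] H x y x′ y′)
        ≤⟨ ∑-mono S (λ x → ∑-mono S λ y → split x y) ⟩
      (∑[ x ← S ] ∑[ y ← S ] (J x y + 𝟙 (proj₁ x ∧ proj₁ y ≟ 0#) * (n * q)))
        ≡⟨ trans (∑-cong S λ x → ∑-+ S _ _) (∑-+ S _ _) ⟩
      (∑[ x ← S ] ∑[ y ← S ] J x y) + (∑[ x ← S ] ∑[ y ← S ] 𝟙 (proj₁ x ∧ proj₁ y ≟ 0#) * (n * q))
        ≡⟨ cong₂ _+_ ∑-ν² (∑-cong S λ x → ∑-*ʳ S (n * q) _) ⟩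
      (∑[ t ← scalars ] ν E t ²) + (∑[ x ← S ] (∑[ y ← S ] 𝟙 (proj₁ x ∧ proj₁ y ≟ 0#)) * (n * q))
        ≤⟨ +-monoʳ-≤ (∑[ t ← scalars ] ν E t ²) (∑-≤-const S (q * (n * q)) λ x →
             *-monoˡ-≤ (n * q) (line proj₁ (set! E) (proj₁ x) 0# (nonzero x))) ⟩
      (∑[ t ← scalars ] ν E t ²) + n * (q * (n * q))
        ≡⟨ cong ((∑[ t ← scalars ] ν E t ²) +_) (*-assoc n q (n * q)) ⟨
      (∑[ t ← scalars ] ν E t ²) + n * q * (n * q) ∎
      where
      open ≤-Reasoning
      J : Member → Member → ℕ
      J x y = ∑[ x′ ← S ] ∑[ y′ ← S ] 𝟙 (proj₁ x ∧ proj₁ y ≟ proj₁ x′ ∧ proj₁ y′)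
      split : ∀ x y → (∑[ x′ ← S ] ∑[ y′ ← S ] H x y x′ y′) ≤ J x y + 𝟙 (proj₁ x ∧ proj₁ y ≟ 0#) * (n * q)
      split x y = go (proj₁ x ∧ proj₁ y ≟ 0#)
        where
        go : (d : Dec (proj₁ x ∧ proj₁ y ≈ 0#)) → (∑[ x′ ← S ] ∑[ y′ ← S ] H x y x′ y′) ≤ J x y + 𝟙 d * (n * q)
        go (yes _) = ≤-trans (∑∑-H x y) (≤-trans (≤-reflexive (sym (+-identityʳ (n * q)))) (m≤n+m _ (J x y)))
        go (no xy≉0) = ≤-trans (∑-mono S λ x′ → ∑-mono S λ y′ → H-independent x y x′ y′ xy≉0) (m≤m+n (J x y) _)

    -- The main term of `ν-²` and the order of SL₂ each give `q ^ 3 * n ² ²`, which the cross term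
    -- cancels. Of the two remaining `q ^ 6 * n ²`, one comes from the deviation of `ν` and one from
    -- dependent pairs.
    f-dispersion : .{{_ : NonZero q}} → (∑[ g ← matrices ] ∣ q ² * f g - n ² ∣ ²) ≤ 2 * q ^ 6 * n ²
    f-dispersion = +-cancelʳ-≤ (2 * q ^ 3 * n ² ²) _ _ (begin
      V + 2 * q ^ 3 * n ² ²
        ≡⟨ cong (V +_) (lemma₁ q n) ⟩
      V + 2 * q ² * n ² * (n * (n * q))
        ≤⟨ +-monoʳ-≤ V (*-monoʳ-≤ (2 * q ² * n ²) ∑-f) ⟩
      V + 2 * q ² * n ² * ∑ matrices f
        ≡⟨ ∑∣-∣² matrices (q ²) (n ²) f ⟩
      q ² ² * ∑ matrices (λ g → f g ²) + length matrices * n ² ²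
        ≤⟨ +-mono-≤ (*-monoʳ-≤ (q ² ²) f-²-≤) (*-monoˡ-≤ (n ² ²) ∣SL₂∣) ⟩
      q ² ² * ((∑[ t ← scalars ] ν E t ²) + n * q * (n * q)) + q ^ 3 * n ² ²
        ≡⟨ lemma₂ q n _ ⟩
      q ^ 3 * (q * (∑[ t ← scalars ] ν E t ²)) + q ^ 6 * n ² + q ^ 3 * n ² ²
        ≤⟨ +-monoˡ-≤ _ (+-monoˡ-≤ _ (*-monoʳ-≤ (q ^ 3) (*-cancelˡ-≤ q (ν-² E)))) ⟩
      q ^ 3 * (n ² ² + q ^ 3 * n ²) + q ^ 6 * n ² + q ^ 3 * n ² ²
        ≡⟨ lemma₃ q n ⟩
      2 * q ^ 6 * n ² + 2 * q ^ 3 * n ² ² ∎)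
      where
      open ≤-Reasoning
      V = ∑[ g ← matrices ] ∣ q ² * f g - n ² ∣ ²
      lemma₁ : ∀ q n → 2 * (q * (q * (q * 1))) * (n * n * (n * n)) ≡ 2 * (q * q) * (n * n) * (n * (n * q))
      lemma₁ = solve-∀
      lemma₂ : ∀ q n s → (q * q) * (q * q) * (s + n * q * (n * q)) + (q * (q * (q * 1))) * (n * n * (n * n)) ≡
                         (q * (q * (q * 1))) * (q * s) + (q * (q * (q * (q * (q * (q * 1)))))) * (n * n) + (q * (q * (q * 1))) * (n * n * (n * n))
      lemma₂ = solve-∀
      lemma₃ : ∀ q n → (q * (q * (q * 1))) * (n * n * (n * n) + (q * (q * (q * 1))) * (n * n)) + (q * (q * (q * (q * (q * (q * 1)))))) * (n * n) + (q * (q * (q * 1))) * (n * n * (n * n)) ≡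
                       2 * (q * (q * (q * (q * (q * (q * 1)))))) * (n * n) + 2 * (q * (q * (q * 1))) * (n * n * (n * n))
      lemma₃ = solve-∀

-- Tuples, Cauchy-Schwarz over classes, and higher moments

∏ : Vector ℕ k → ℕ
∏ = Product.sum

∏-const : ∀ n m → ∏ {n} (const m) ≡ m ^ n
∏-const zero    m = refl
∏-const (suc n) m = cong (m *_) (∏-const n m)

∏-1 : (φ : Vector ℕ k) → (∀ i → φ i ≡ 1) → ∏ φ ≡ 1
∏-1 {zero}  φ φ≡1 = refl
∏-1 {suc k} φ φ≡1 = cong₂ _*_ (φ≡1 Fin.zero) (∏-1 (φ ∘ Fin.suc) (φ≡1 ∘ Fin.suc))

-- Each coordinate has its own list: a constant choice gives the powers of a set, a varying one the
-- normal forms of configurations.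
tuples : Vector (List A) k → List (Vector A k)
tuples {k = zero}  L = Vector.[] ∷ []
tuples {k = suc k} L = cartesianProductWith Vector._∷_ (L Fin.zero) (tuples (L ∘ Fin.suc))

length-tuples : (L : Vector (List A) k) → length (tuples L) ≡ ∏ (length ∘ L)
length-tuples {k = zero}  L = refl
length-tuples {k = suc k} L = trans (length-cartesianProductWith Vector._∷_ (L Fin.zero) (tuples (L ∘ Fin.suc)))
  (cong (length (L Fin.zero) *_) (length-tuples (L ∘ Fin.suc)))

tuples⁺ : {P : Fin k → A → Set p} {L : Vector (List A) k} → (∀ i → Any (P i) (L i)) →
          Any (λ w → ∀ i → P i (w i)) (tuples L)
tuples⁺ {k = zero}  any = here λ ()
tuples⁺ {k = suc k} any = cartesianProductWith⁺ Vector._∷_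
  (λ px pw → λ { Fin.zero → px ; (Fin.suc i) → pw i }) (any Fin.zero) (tuples⁺ (any ∘ Fin.suc))

-- Distributivity; through it the number of pairs of tuples matched by one matrix becomes a power of
-- `f`.
∑-∏ : (L : Vector (List A) k) (φ : Fin k → A → ℕ) →
      (∑[ w ← tuples L ] ∏ (λ i → φ i (w i))) ≡ ∏ (λ i → ∑ (L i) (φ i))
∑-∏ {k = zero}  L φ = refl
∑-∏ {k = suc k} L φ = begin
  (∑[ w ← tuples L ] ∏ (λ i → φ i (w i)))
    ≡⟨ ∑-cartesianProductWith Vector._∷_ (L Fin.zero) (tuples (L ∘ Fin.suc)) _ ⟩
  (∑[ x ← L Fin.zero ] ∑[ w ← tuples (L ∘ Fin.suc) ] φ Fin.zero x * ∏ (λ i → φ (Fin.suc i) (w i)))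
    ≡⟨ ∑-* (L Fin.zero) (tuples (L ∘ Fin.suc)) (φ Fin.zero) (λ w → ∏ (λ i → φ (Fin.suc i) (w i))) ⟨
  ∑ (L Fin.zero) (φ Fin.zero) * (∑[ w ← tuples (L ∘ Fin.suc) ] ∏ (λ i → φ (Fin.suc i) (w i)))
    ≡⟨ cong (∑ (L Fin.zero) (φ Fin.zero) *_) (∑-∏ (L ∘ Fin.suc) (φ ∘ Fin.suc)) ⟩
  ∏ (λ i → ∑ (L i) (φ i)) ∎
  where open ≡-Reasoning

-- Cauchy–Schwarz over the classes cs of a weighted family.
class-energy : {R : A → B → Set r} {_∼_ : A → A → Set s} (R? : ∀ x c → Dec (R x c)) (_∼?_ : ∀ x y → Dec (x ∼ y))
               (xs : List A) (cs : List B) (ω : A → ℕ) →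
               (∀ x → (∑[ c ← cs ] 𝟙 (R? x c)) ≡ 1) → (∀ {x y c} → R x c → R y c → x ∼ y) →
               ∑ xs ω ² ≤ length cs * (∑[ x ← xs ] ∑[ y ← xs ] ω x * ω y * 𝟙 (x ∼? y))
class-energy R? _∼?_ xs cs ω total R⇒∼ = begin
  ∑ xs ω ²
    ≡⟨ cong _² (∑-cong xs λ x → trans (sym (*-identityʳ (ω x))) (cong (ω x *_) (sym (total x)))) ⟩
  (∑[ x ← xs ] ω x * (∑[ c ← cs ] 𝟙 (R? x c))) ²
    ≡⟨ cong _² (trans (∑-cong xs λ x → sym (∑-*ˡ cs (ω x) _)) (∑-swap xs cs _)) ⟩
  (∑[ c ← cs ] weight c) ²
    ≤⟨ cauchy-schwarz cs weight ⟩
  length cs * (∑[ c ← cs ] weight c ²)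
    ≡⟨ cong (length cs *_) (∑-cong cs λ c → ∑-* xs xs _ _) ⟩
  length cs * (∑[ c ← cs ] ∑[ x ← xs ] ∑[ y ← xs ] term c x y)
    ≡⟨ cong (length cs *_) (trans (∑-swap cs xs _) (∑-cong xs λ x → ∑-swap cs xs _)) ⟩
  length cs * (∑[ x ← xs ] ∑[ y ← xs ] ∑[ c ← cs ] term c x y)
    ≤⟨ *-monoʳ-≤ (length cs) (∑-mono xs λ x → ∑-mono xs λ y → collapse x y) ⟩
  length cs * (∑[ x ← xs ] ∑[ y ← xs ] ω x * ω y * 𝟙 (x ∼? y)) ∎
  where
  open ≤-Reasoning
  weight : _ → ℕ
  weight c = ∑[ x ← xs ] ω x * 𝟙 (R? x c)
  term : _ → _ → _ → ℕ
  term c x y = ω x * 𝟙 (R? x c) * (ω y * 𝟙 (R? y c))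
  lemma₁ : ∀ u a v b → u * a * (v * b) ≡ u * v * (a * b)
  lemma₁ = solve-∀
  -- One factor `𝟙 (R? x c)` is kept so that the sum over `c` collapses to 1 by `total`.
  share : ∀ x y c → 𝟙 (R? x c) * 𝟙 (R? y c) ≤ 𝟙 (x ∼? y) * 𝟙 (R? x c)
  share x y c = begin
    𝟙 (R? x c) * 𝟙 (R? y c)  ≡⟨ *-comm (𝟙 (R? x c)) _ ⟩
    𝟙 (R? y c) * 𝟙 (R? x c)  ≤⟨ 𝟙-*-≤ (R? y c) (λ ryc → 𝟙-≤ (R? x c) λ rxc →
                                  ≤-reflexive (sym (cong₂ _*_ (𝟙-yes (x ∼? y) (R⇒∼ rxc ryc)) (𝟙-yes (R? x c) rxc)))) ⟩
    𝟙 (x ∼? y) * 𝟙 (R? x c)  ∎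
  collapse : ∀ x y → (∑[ c ← cs ] term c x y) ≤ ω x * ω y * 𝟙 (x ∼? y)
  collapse x y = begin
    (∑[ c ← cs ] term c x y)
      ≡⟨ ∑-cong cs (λ c → lemma₁ (ω x) (𝟙 (R? x c)) (ω y) (𝟙 (R? y c))) ⟩
    (∑[ c ← cs ] ω x * ω y * (𝟙 (R? x c) * 𝟙 (R? y c)))
      ≤⟨ ∑-mono cs (λ c → *-monoʳ-≤ (ω x * ω y) (share x y c)) ⟩
    (∑[ c ← cs ] ω x * ω y * (𝟙 (x ∼? y) * 𝟙 (R? x c)))
      ≡⟨ trans (∑-*ˡ cs (ω x * ω y) _) (cong (ω x * ω y *_) (∑-*ˡ cs (𝟙 (x ∼? y)) _)) ⟩
    ω x * ω y * (𝟙 (x ∼? y) * (∑[ c ← cs ] 𝟙 (R? x c)))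
      ≡⟨ cong (ω x * ω y *_) (trans (cong (𝟙 (x ∼? y) *_) (total x)) (*-identityʳ _)) ⟩
    ω x * ω y * 𝟙 (x ∼? y) ∎

^-distribʳ-* : ∀ k m n → (m * n) ^ k ≡ m ^ k * n ^ k
^-distribʳ-* zero    m n = refl
^-distribʳ-* (suc k) m n = trans (cong (m * n *_) (^-distribʳ-* k m n)) (lemma m n (m ^ k) (n ^ k))
  where
  lemma : ∀ m n a b → m * n * (a * b) ≡ m * a * (n * b)
  lemma = solve-∀

-- Either x ≤ 2M, or x ≤ 2∣x − M∣.
moment-split : ∀ x M B m → x ≤ B → x ^ (2 + m) ≤ (2 * M) ^ (2 + m) + 4 * B ^ m * ∣ x - M ∣ ²
moment-split x M B m x≤B with ≤-total x (2 * M)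
... | inj₁ x≤2M = ≤-trans (^-monoˡ-≤ (2 + m) x≤2M) (m≤m+n _ _)
... | inj₂ 2M≤x = ≤-trans bound (m≤n+m _ ((2 * M) ^ (2 + m)))
  where
  open ≤-Reasoning
  D = ∣ x - M ∣
  x≤D+M : x ≤ D + M
  x≤D+M = ≤-trans (m≤n+∣m-n∣ x M) (≤-reflexive (+-comm M D))
  M≤D : M ≤ D
  M≤D = +-cancelʳ-≤ M M D (≤-trans (≤-reflexive (cong (M +_) (sym (+-identityʳ M)))) (≤-trans 2M≤x x≤D+M))
  x≤2D : x ≤ 2 * D
  x≤2D = ≤-trans x≤D+M (≤-trans (+-monoʳ-≤ D M≤D) (≤-reflexive (cong (D +_) (sym (+-identityʳ D)))))
  lemma : ∀ D b → 2 * D * (2 * D * b) ≡ 4 * b * (D * D)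
  lemma = solve-∀
  bound : x ^ (2 + m) ≤ 4 * B ^ m * D ²
  bound = begin
    -- Two factors are paid for by the deviation, the other `m` by the trivial bound `B`.
    x * (x * x ^ m)          ≤⟨ *-mono-≤ x≤2D (*-mono-≤ x≤2D (^-monoˡ-≤ m x≤B)) ⟩
    2 * D * (2 * D * B ^ m)  ≡⟨ lemma D (B ^ m) ⟩
    4 * B ^ m * D ²          ∎

-- Lower bound for the number of classes of a subset

module Moments {c ℓ} (F : FiniteField c ℓ) {e} (E : Subset (FiniteField.plane F) e)
  (E≉0 : ∀ {x} → Subset.member E x → ¬ PlaneGeometry._≈ₚ_ F x (PlaneGeometry.0ₚ F)) where
  open PlaneGeometry F
  open Incidence F
  open SpecialLinear F
  open FiniteField F using () renaming (_≟_ to infix 4 _≟_)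
  private
    module F = FiniteField F
    module plane = FiniteSetoid plane
    module Gs = Enumeration (subset (plane ×ᶠ plane) SL₂)
    n = N E
    φ : Matrix → ℕ
    φ = f E E≉0

  -- The term `2 ^ (2 + m)` comes from values up to twice the mean. The 8 is the 4 of `moment-split`
  -- times the 2 of `f-dispersion`; `large` is exactly what brings that contribution down to the
  -- size of the main term.
  moment : .{{_ : NonZero q}} (m : ℕ) → q * q ² * (q ²) ^ m ≤ n ^ (2 + m) →
           q * (q ²) ^ m * (∑[ g ← matrices ] φ g ^ (2 + m)) ≤ (2 ^ (2 + m) + 8) * (n ^ (2 + m)) ²
  -- The extra `q ^ 3` completes `q * R` to `(q ²) ^ (2 + m)`, the denominator of the mean raised to
  -- the moment.
  moment m large = *-cancelˡ-≤ (q ^ 3) {{m^n≢0 q 3}} (begin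
    q ^ 3 * (q * R * (∑[ g ← matrices ] φ g ^ (2 + m)))
      ≡⟨ lemma₁ q R _ ⟩
    (q ²) ^ (2 + m) * (∑[ g ← matrices ] φ g ^ (2 + m))
      ≡⟨ ∑-*ˡ matrices ((q ²) ^ (2 + m)) _ ⟨
    (∑[ g ← matrices ] (q ²) ^ (2 + m) * φ g ^ (2 + m))
      ≡⟨ ∑-cong matrices (λ g → ^-distribʳ-* (2 + m) (q ²) (φ g)) ⟨
    (∑[ g ← matrices ] (q ² * φ g) ^ (2 + m))
      ≤⟨ ∑-mono matrices (λ g → moment-split (q ² * φ g) (n ²) (q ² * n) m (*-monoʳ-≤ (q ²) (f≤n E E≉0 g))) ⟩
    (∑[ g ← matrices ] ((2 * n ²) ^ (2 + m) + 4 * (q ² * n) ^ m * ∣ q ² * φ g - n ² ∣ ²))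
      ≡⟨ trans (∑-+ matrices _ _) (cong₂ _+_ (∑-const matrices _) (∑-*ˡ matrices (4 * (q ² * n) ^ m) _)) ⟩
    length matrices * (2 * n ²) ^ (2 + m) + 4 * (q ² * n) ^ m * (∑[ g ← matrices ] ∣ q ² * φ g - n ² ∣ ²)
      ≤⟨ +-mono-≤ (*-monoˡ-≤ _ ∣SL₂∣) (*-monoʳ-≤ (4 * (q ² * n) ^ m) (f-dispersion E E≉0)) ⟩
    q ^ 3 * (2 * n ²) ^ (2 + m) + 4 * (q ² * n) ^ m * (2 * q ^ 6 * n ²)
      ≡⟨ cong₂ (λ u v → q ^ 3 * u + 4 * v * (2 * q ^ 6 * n ²))
           (trans (^-distribʳ-* (2 + m) 2 (n ²)) (cong (2 ^ (2 + m) *_) (^-distribʳ-* (2 + m) n n)))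
           (^-distribʳ-* m (q ²) n) ⟩
    q ^ 3 * (2 ^ (2 + m) * (n ^ (2 + m)) ²) + 4 * (R * n ^ m) * (2 * q ^ 6 * n ²)
      ≡⟨ lemma₂ q R (2 ^ (2 + m)) n (n ^ m) ⟩
    q ^ 3 * (2 ^ (2 + m) * (n ^ (2 + m)) ² + 8 * (q * q ² * R * n ^ (2 + m)))
      ≤⟨ *-monoʳ-≤ (q ^ 3) (+-monoʳ-≤ (2 ^ (2 + m) * (n ^ (2 + m)) ²) (*-monoʳ-≤ 8 (*-monoˡ-≤ (n ^ (2 + m)) large))) ⟩
    q ^ 3 * (2 ^ (2 + m) * (n ^ (2 + m)) ² + 8 * (n ^ (2 + m)) ²)
      ≡⟨ cong (q ^ 3 *_) (*-distribʳ-+ ((n ^ (2 + m)) ²) (2 ^ (2 + m)) 8) ⟨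
    q ^ 3 * ((2 ^ (2 + m) + 8) * (n ^ (2 + m)) ²) ∎)
    where
    open ≤-Reasoning
    R = (q ²) ^ m
    lemma₁ : ∀ q R s → (q * (q * (q * 1))) * (q * R * s) ≡ (q * q) * ((q * q) * R) * s
    lemma₁ = solve-∀
    lemma₂ : ∀ q R t n N → (q * (q * (q * 1))) * (t * ((n * (n * N)) * (n * (n * N)))) +
               4 * (R * N) * (2 * (q * (q * (q * (q * (q * (q * 1)))))) * (n * n)) ≡
             (q * (q * (q * 1))) * (t * ((n * (n * N)) * (n * (n * N))) + 8 * (q * (q * q) * R * (n * (n * N))))
    lemma₂ = solve-∀

  private
    Member : Set _
    Member = ∃ (Subset.member E)
    S : List Member
    S = set E

  module _ (m : ℕ) where
    Tuple : Set _
    Tuple = Vector Member (2 + m)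

    tuplesOf : List Tuple
    tuplesOf = tuples (const S)

    private
      first second : Tuple → Point
      first  w = proj₁ (w Fin.zero)
      second w = proj₁ (w (Fin.suc Fin.zero))

    independent? : (w : Tuple) → Dec (¬ first w ∧ second w ≈ 0#)
    independent? w = ¬? (first w ∧ second w ≟ 0#)

    independents : ℕ
    independents = ∑[ w ← tuplesOf ] 𝟙 (independent? w)

    -- The line through the origin and the first entry holds at most `q` points, half of `n` or
    -- fewer, so at least half of the second entries are independent of it.
    independents-≥ : 2 * q ≤ n → n ^ (2 + m) ≤ 2 * independents
    independents-≥ 2q≤n = begin
      n * (n * n ^ m)
        ≤⟨ ∑-≥-const S (n * n ^ m) (λ x → ≤-trans (*-monoˡ-≤ (n ^ m) (row x)) (≤-reflexive (*-assoc 2 (I x) (n ^ m)))) ⟩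
      (∑[ x ← S ] 2 * (I x * n ^ m))
        ≡⟨ ∑-*ˡ S 2 _ ⟩
      2 * (∑[ x ← S ] I x * n ^ m)
        ≡⟨ cong (2 *_) expand ⟨
      2 * independents ∎
      where
      open ≤-Reasoning
      I : Member → ℕ
      I x = ∑[ y ← S ] 𝟙 (¬? (proj₁ x ∧ proj₁ y ≟ 0#))
      rest : List (Vector Member m)
      rest = tuples (const S)
      𝟙-¬ : ∀ {p} {P : Set p} (P? : Dec P) → 1 ≡ 𝟙 (¬? P?) + 𝟙 P?
      𝟙-¬ (yes _) = refl
      𝟙-¬ (no _)  = refl
      row : ∀ x → n ≤ 2 * I x
      row x = +-cancelʳ-≤ n _ _ (begin
        n + n                     ≡⟨ cong (n +_) (+-identityʳ n) ⟨
        2 * n                     ≤⟨ *-monoʳ-≤ 2 split ⟩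
        2 * (I x + q)             ≡⟨ *-distribˡ-+ 2 (I x) q ⟩
        2 * I x + 2 * q           ≤⟨ +-monoʳ-≤ (2 * I x) 2q≤n ⟩
        2 * I x + n               ∎)
        where
        split : n ≤ I x + q
        split = begin
          n                     ≡⟨ *-identityʳ n ⟨
          n * 1                 ≡⟨ ∑-const S 1 ⟨
          (∑[ y ← S ] 1)        ≡⟨ ∑-cong S (λ y → 𝟙-¬ (proj₁ x ∧ proj₁ y ≟ 0#)) ⟩
          (∑[ y ← S ] (𝟙 (¬? (proj₁ x ∧ proj₁ y ≟ 0#)) + 𝟙 (proj₁ x ∧ proj₁ y ≟ 0#)))
                                ≡⟨ ∑-+ S _ _ ⟩
          I x + (∑[ y ← S ] 𝟙 (proj₁ x ∧ proj₁ y ≟ 0#))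
                                ≤⟨ +-monoʳ-≤ (I x) (line proj₁ (set! E) (proj₁ x) 0# (E≉0 (proj₂ x))) ⟩
          I x + q               ∎
      length-rest : length rest ≡ n ^ m
      length-rest = trans (length-tuples {k = m} (const S)) (∏-const m n)
      expand : independents ≡ (∑[ x ← S ] I x * n ^ m)
      expand = trans (∑-cartesianProductWith Vector._∷_ S (tuples (const S)) (𝟙 ∘ independent?))
        (∑-cong S λ x → trans (∑-cartesianProductWith Vector._∷_ S rest _)
          (trans (∑-cong S λ y → trans (∑-const rest _) (trans (cong (_* _) length-rest) (*-comm (n ^ m) _)))
            (∑-*ʳ S (n ^ m) _)))

    ∑-tuples : ∀ g → (∑[ v ← tuplesOf ] ∑[ w ← tuplesOf ] ∏ (λ i → 𝟙 (g $ proj₁ (v i) ≟ₚ proj₁ (w i)))) ≡ φ g ^ (2 + m)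
    ∑-tuples g = begin
      (∑[ v ← tuplesOf ] ∑[ w ← tuplesOf ] ∏ (λ i → 𝟙 (g $ proj₁ (v i) ≟ₚ proj₁ (w i))))
        ≡⟨ ∑-cong tuplesOf (λ v → ∑-∏ (const S) (λ i y → 𝟙 (g $ proj₁ (v i) ≟ₚ proj₁ y))) ⟩
      (∑[ v ← tuplesOf ] ∏ (λ i → ∑[ y ← S ] 𝟙 (g $ proj₁ (v i) ≟ₚ proj₁ y)))
        ≡⟨ ∑-∏ (const S) (λ _ x → ∑[ y ← S ] 𝟙 (g $ proj₁ x ≟ₚ proj₁ y)) ⟩
      ∏ {2 + m} (const (φ g))
        ≡⟨ ∏-const (2 + m) (φ g) ⟩
      φ g ^ (2 + m) ∎
      where open ≡-Reasoning

    -- The matrix carrying the leading pair of `v` to that of `w` carries every other entry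
    -- correctly, since an entry is determined by its products with the leading pair.
    connect : ∀ v w → ¬ first v ∧ second v ≈ 0# → (proj₁ ∘ v) ∼ (proj₁ ∘ w) →
              1 ≤ (∑[ g ← matrices ] ∏ (λ i → 𝟙 (g $ proj₁ (v i) ≟ₚ proj₁ (w i))))
    connect v w independent v∼w =
      let (g , uv≈1 , gx≈x′ , gy≈y′) = transporter (first v) (second v) (first w) (second w)
                                        independent (v∼w Fin.zero (Fin.suc Fin.zero))
      in 1≤∑ (Any.map
           (λ {h} g≈h → ≤-reflexive (sym (∏-1 {2 + m} _ λ i → 𝟙-yes (h $ proj₁ (v i) ≟ₚ proj₁ (w i))
             (plane.trans (∙-congʳ (proj₁ (v i)) (FiniteSetoid.sym (plane ×ᶠ plane) g≈h))
               (maps (g , uv≈1) gx≈x′ gy≈y′ i)))))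
           (Gs.list-complete (g , uv≈1)))
      where
      maps : ∀ g → g $ first v ≈ₚ first w → g $ second v ≈ₚ second w → ∀ i → g $ proj₁ (v i) ≈ₚ proj₁ (w i)
      maps g gx≈x′ gy≈y′ i = ∧-separates
        -- The leading pair of `w` is independent because it spans the same area as that of `v`.
        (λ x′y′≈0 → independent (F.trans (v∼w Fin.zero (Fin.suc Fin.zero)) x′y′≈0))
        (F.trans (∧-cong (plane.sym gx≈x′) plane.refl)
          (F.trans ($-∧ g (first v) (proj₁ (v i))) (v∼w Fin.zero i)))
        (F.trans (∧-cong {g $ proj₁ (v i)} plane.refl (plane.sym gy≈y′))
          (F.trans ($-∧ g (proj₁ (v i)) (second v)) (v∼w i (Fin.suc Fin.zero))))

    module _ {e′} (E₀ : Subset plane e′) (E⊆E₀ : ∀ {x} → Subset.member E x → Subset.member E₀ x) where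
      private
        𝒞 = classes F (2 + m) E₀
        module 𝒞 = FiniteSetoid 𝒞
        module Cs = Enumeration 𝒞

        embed : Tuple → 𝒞.Carrier
        embed w i = proj₁ (w i) , E⊆E₀ (proj₂ (w i))

        ω : Tuple → ℕ
        ω w = 𝟙 (independent? w)

      -- The tuples avoid the origin but the classes are those of `E₀`, which may contain it; only a
      -- lower bound on their number is sought.
      independents-² : independents ² ≤ ∣ 𝒞 ∣ * (∑[ g ← matrices ] φ g ^ (2 + m))
      independents-² = begin
        independents ²
          ≤⟨ class-energy (λ w c → embed w 𝒞.≟ c) (λ v w → embed v 𝒞.≟ embed w) tuplesOf Cs.list ω
               (λ w → Cs.∑-≟ (embed w))
               (λ {v} {w} {c} v∼c w∼c → 𝒞.trans {embed v} {c} {embed w} v∼c (𝒞.sym {embed w} {c} w∼c)) ⟩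
        ∣ 𝒞 ∣ * (∑[ v ← tuplesOf ] ∑[ w ← tuplesOf ] ω v * ω w * 𝟙 (embed v 𝒞.≟ embed w))
          ≤⟨ *-monoʳ-≤ ∣ 𝒞 ∣ (∑-mono tuplesOf λ v → ∑-mono tuplesOf λ w → pair v w) ⟩
        ∣ 𝒞 ∣ * (∑[ v ← tuplesOf ] ∑[ w ← tuplesOf ] ∑[ g ← matrices ] moves g v w)
          ≡⟨ cong (∣ 𝒞 ∣ *_) (trans (∑-cong tuplesOf λ v → ∑-swap tuplesOf matrices _) (∑-swap tuplesOf matrices _)) ⟩
        ∣ 𝒞 ∣ * (∑[ g ← matrices ] ∑[ v ← tuplesOf ] ∑[ w ← tuplesOf ] moves g v w)
          ≡⟨ cong (∣ 𝒞 ∣ *_) (∑-cong matrices ∑-tuples) ⟩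
        ∣ 𝒞 ∣ * (∑[ g ← matrices ] φ g ^ (2 + m)) ∎
        where
        open ≤-Reasoning
        moves : Matrix → Tuple → Tuple → ℕ
        moves g v w = ∏ (λ i → 𝟙 (g $ proj₁ (v i) ≟ₚ proj₁ (w i)))
        pair : ∀ v w → ω v * ω w * 𝟙 (embed v 𝒞.≟ embed w) ≤ (∑[ g ← matrices ] moves g v w)
        pair v w = begin
          ω v * ω w * 𝟙 (embed v 𝒞.≟ embed w)    ≡⟨ *-assoc (ω v) (ω w) _ ⟩
          ω v * (ω w * 𝟙 (embed v 𝒞.≟ embed w))  ≤⟨ 𝟙-*-≤ (independent? v) (λ independent →
                                                       ≤-trans (*-monoˡ-≤ _ (𝟙≤1 (independent? w)))
                                                         (≤-trans (≤-reflexive (*-identityˡ _))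
                                                           (𝟙-≤ (embed v 𝒞.≟ embed w) (connect v w independent)))) ⟩
          (∑[ g ← matrices ] moves g v w)        ∎

-- Upper bound for the number of classes of the plane

length-concatMap : (h : A → List B) (xs : List A) → length (concatMap h xs) ≡ ∑ xs (length ∘ h)
length-concatMap h []       = refl
length-concatMap h (x ∷ xs) = trans (length-++ (h x)) (cong (length (h x) +_) (length-concatMap h xs))

module Representatives {c ℓ} (F : FiniteField c ℓ) (m : ℕ) where
  open PlaneGeometry F
  open Incidence F
  open FiniteField F using (_*ᴿ_; inverse) renaming (_≟_ to infix 4 _≟_)
  private
    module F = FiniteField F
    module Fs = Enumeration finiteSetoid
    module Ps = Enumeration plane
    R = (q ²) ^ m

    choose : ∀ {P Q : Set} → Dec P → Dec Q → List Point
    choose (yes _) _       = [ 1# , 0# ]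
    choose (no _)  (yes _) = map (0# ,_) scalars
    choose (no _)  (no _)  = points

    coordinates : (i j : Fin (2 + m)) → Vector (List Point) (2 + m)
    coordinates i j l = choose (i Fin.≟ l) (j Fin.≟ l)

    -- One coordinate is fixed, one runs over an axis and `m` are free. Writing the second index as
    -- `punchIn i j′` makes it differ from `i` by construction and lets both be split off the
    -- product.
    length-coordinates : ∀ i j′ → length (tuples (coordinates i (punchIn i j′))) ≡ q * R
    length-coordinates i j′ = begin
      length (tuples L)
        ≡⟨ length-tuples L ⟩
      ∏ (length ∘ L)
        ≡⟨ Product.sum-remove {i = i} (length ∘ L) ⟩
      length (L i) * ∏ (length ∘ L ∘ punchIn i)
        ≡⟨ cong₂ _*_ at-i (Product.sum-remove {i = j′} (length ∘ L ∘ punchIn i)) ⟩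
      1 * (length (L j) * ∏ (length ∘ L ∘ punchIn i ∘ punchIn j′))
        ≡⟨ *-identityˡ _ ⟩
      length (L j) * ∏ (length ∘ L ∘ punchIn i ∘ punchIn j′)
        ≡⟨ cong₂ _*_ at-j (trans (Product.sum-cong-≗ elsewhere) (∏-const m (q ²))) ⟩
      q * R ∎
      where
      open ≡-Reasoning
      j = punchIn i j′
      L = coordinates i j
      at-i : length (L i) ≡ 1
      at-i with i Fin.≟ i
      ... | yes _  = refl
      ... | no i≢i = contradiction refl i≢i
      at-j : length (L j) ≡ q
      at-j with i Fin.≟ j | j Fin.≟ j
      ... | yes i≡j | _      = contradiction (sym i≡j) (punchInᵢ≢i i j′)
      ... | no _    | yes _  = length-map (0# ,_) scalars
      ... | no _    | no j≢j = contradiction refl j≢j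
      elsewhere : ∀ l → length (L (punchIn i (punchIn j′ l))) ≡ q ²
      elsewhere l with i Fin.≟ punchIn i (punchIn j′ l) | j Fin.≟ punchIn i (punchIn j′ l)
      ... | yes eq | _      = contradiction (sym eq) (punchInᵢ≢i i _)
      ... | no _   | yes eq = contradiction (sym (punchIn-injective i _ _ eq)) (punchInᵢ≢i j′ l)
      ... | no _   | no _   = ∣plane∣

    pairs : List (Fin (2 + m) × Fin (1 + m))
    pairs = cartesianProduct (allFin _) (allFin _)

    normalised : Fin (2 + m) × Fin (1 + m) → List (Vector Point (2 + m))
    normalised (i , j′) = tuples (coordinates i (punchIn i j′))

  -- Up to equivalence, x is zero or satisfies xⁱ = (1 , 0) and xʲ = (0 , D) for some i ≠ j.
  representatives : List (Vector Point (2 + m))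
  representatives = const 0ₚ ∷ concatMap normalised pairs

  length-representatives : length representatives ≡ 1 + (2 + m) * (1 + m) * (q * R)
  length-representatives = cong suc (begin
    length (concatMap normalised pairs)   ≡⟨ length-concatMap normalised pairs ⟩
    ∑ pairs (length ∘ normalised)         ≡⟨ ∑-cong pairs (λ (i , j′) → length-coordinates i j′) ⟩
    (∑[ _ ← pairs ] q * R)                ≡⟨ ∑-const pairs (q * R) ⟩
    length pairs * (q * R)                ≡⟨ cong (_* (q * R)) (trans
                                               (length-cartesianProductWith _,_ (allFin (2 + m)) (allFin (1 + m)))
                                               (cong₂ _*_ (length-tabulate {n = 2 + m} id) (length-tabulate {n = 1 + m} id))) ⟩
    (2 + m) * (1 + m) * (q * R)           ∎)
    where open ≡-Reasoning

  private
    module Normalise (x : Vector Point (2 + m)) {i j} (independent : ¬ x i ∧ x j ≈ 0#) where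
      D d : Carrier
      D = x i ∧ x j
      d = proj₁ (inverse D independent)
      Dd≈1 : D *ᴿ d ≈ 1#
      Dd≈1 = proj₂ (inverse D independent)

      -- The linear map of determinant `d *ᴿ D`, that is 1, sending `x i` to `(1# , 0#)` and `x j`
      -- to `(0# , D)`.
      h : Point → Point
      h z = d *ᴿ (z ∧ x j) , x i ∧ z

      h-∧ : ∀ z w → h z ∧ h w ≈ z ∧ w
      h-∧ z w = F.trans (plücker d (x i) (x j) z w)
        (F.trans (F.*-congʳ (F.trans (F.*-comm d D) Dd≈1)) (F.*-identityˡ _))

      i≢j : i ≢ j
      i≢j refl = independent (∧-self (x i))

      covered : ∀ l → Any (h (x l) ≈ₚ_) (coordinates i j l)
      covered l with i Fin.≟ l | j Fin.≟ l
      ... | yes refl | _        = here (F.trans (F.*-comm d D) Dd≈1 , ∧-self (x i))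
      ... | no _     | yes refl = map⁺ (Any.map (F.trans (F.*-congˡ (∧-self (x j))) (F.zeroʳ d) ,_) (Fs.list-complete _))
      ... | no _     | no _     = Ps.list-complete _

      equivalent : Any (x ∼_) (tuples (coordinates i j))
      equivalent = Any.map (λ hx≈r k l → F.trans (F.sym (h-∧ (x k) (x l))) (∧-cong (hx≈r k) (hx≈r l)))
        (tuples⁺ covered)

  representatives-complete : ∀ x → Any (x ∼_) representatives
  representatives-complete x with any? (λ i → any? λ j → ¬? (x i ∧ x j ≟ 0#))
  ... | no degenerate = here λ i j → F.trans
    (decidable-stable (x i ∧ x j ≟ 0#) λ xi∧xj≉0 → degenerate (i , j , xi∧xj≉0)) (F.sym (∧-zeroˡ 0ₚ))
  ... | yes (i , j , independent) = there (concatMap⁺ normalised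
    -- The listed pair is `(i , punchOut i≢j)`, whose second index `punchIn` turns back into `j`.
    (Any.map (λ { refl → subst (λ j → Any (x ∼_) (tuples (coordinates i j))) (sym (punchIn-punchOut i≢j)) equivalent })
      (∈-cartesianProduct⁺ (∈-allFin i) (∈-allFin (punchOut i≢j)))))
    where open Normalise x independent

  ∣classes-whole∣ : ∣ classes F (2 + m) (whole plane) ∣ ≤ 1 + (2 + m) * (1 + m) * (q * R)
  ∣classes-whole∣ = ≤-trans
    (length-≤ {R = λ x y → (proj₁ ∘ x) ∼ y} (λ x y → Fin.all? λ i → Fin.all? λ j → proj₁ (x i) ∧ proj₁ (x j) ≟ y i ∧ y j)
      (Enumeration.list! (classes F (2 + m) (whole plane)))
      (λ x → representatives-complete (proj₁ ∘ x))
      (λ x∼z y∼z i j → F.trans (x∼z i j) (F.sym (y∼z i j))))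
    (≤-reflexive length-representatives)

-- Removal of the origin

module Punctured {c ℓ} (F : FiniteField c ℓ) {e} (E : Subset (FiniteField.plane F) e) where
  open PlaneGeometry F
  open Incidence F
  private
    module plane = FiniteSetoid plane
    module E = Subset E

  E∖0 : Subset plane _
  E∖0 = record
    { member   = λ x → E.member x × ¬ x ≈ₚ 0ₚ
    ; member?  = λ x → E.member? x ×-dec ¬? (x plane.≟ 0ₚ)
    ; respects = λ x≈y (x∈E , x≉0) → E.respects x≈y x∈E , λ y≈0 → x≉0 (plane.trans x≈y y≈0)
    }

  ∣E∣-≤ : ∣ subset plane E ∣ ≤ 1 + N E∖0
  ∣E∣-≤ = ≤-trans
    (length-≤ {R = λ x y → proj₁ x ≈ₚ y} (λ x y → proj₁ x plane.≟ y) (Enumeration.list! (subset plane E))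
      (λ x → cover x (proj₁ x plane.≟ 0ₚ)) (λ x≈z y≈z → plane.trans x≈z (plane.sym y≈z)))
    (≤-reflexive (cong suc (length-map proj₁ (set E∖0))))
    where
    cover : ∀ (x : ∃ E.member) → Dec (proj₁ x ≈ₚ 0ₚ) → Any (proj₁ x ≈ₚ_) (0ₚ ∷ map proj₁ (set E∖0))
    cover x         (yes x≈0) = here x≈0
    cover (x , x∈E) (no x≉0)  = there (map⁺ (Enumeration.list-complete (subset plane E∖0) (x , x∈E , x≉0)))

-- The size threshold and the final comparison

^-cancelˡ-≤ : ∀ k {m n} → m ^ suc k ≤ n ^ suc k → m ≤ n
^-cancelˡ-≤ k m^≤n^ = ≮⇒≥ λ n<m → <⇒≱ (^-monoˡ-< (suc k) n<m) m^≤n^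

critical-power : ∀ q m → q ^ (2 * (2 + m) ∸ 1) ≡ q * q ² * (q ²) ^ m
critical-power q m = begin
  q ^ (1 + m + (2 + (m + 0)))    ≡⟨ cong (λ k → q ^ (1 + m + (2 + k))) (+-identityʳ m) ⟩
  q ^ (1 + m + (2 + m))          ≡⟨ ^-distribˡ-+-* q (1 + m) (2 + m) ⟩
  q ^ (1 + m) * q ^ (2 + m)      ≡⟨ lemma q (q ^ m) ⟩
  q * q ² * (q ^ m * q ^ m)      ≡⟨ cong (q * q ² *_) (^-distribʳ-* m q q) ⟨
  q * q ² * (q ²) ^ m            ∎
  where
  open ≡-Reasoning
  lemma : ∀ q r → q * r * (q * (q * r)) ≡ q * (q * q) * (r * r)
  lemma = solve-∀

-- The constant 4 leaves room to discard the origin and the dependent leading pairs.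
large-set : ∀ q .{{_ : NonZero q}} m {E n} → E ≤ 1 + n → 4 ^ (2 + m) * q ^ (2 * (2 + m) ∸ 1) ≤ E ^ (2 + m) →
            2 * q ≤ n × q * q ² * (q ²) ^ m ≤ n ^ (2 + m)
large-set q m {E} {n} E≤1+n hyp = 2q≤n , *-cancelˡ-≤ (4 ^ (2 + m)) {{m^n≢0 4 (2 + m)}} (begin
  4 ^ (2 + m) * (q * q ² * (q ²) ^ m)         ≡⟨ cong (4 ^ (2 + m) *_) (critical-power q m) ⟨
  4 ^ (2 + m) * q ^ (2 * (2 + m) ∸ 1)         ≤⟨ hyp ⟩
  -- Only `2 * n` is needed here; the full 4 is spent on `2 * q ≤ n`, through `4 * q ≤ E ≤ 2 * n`.
  E ^ (2 + m)                                 ≤⟨ ^-monoˡ-≤ (2 + m) (≤-trans E≤2n (*-monoˡ-≤ n {2} {4} (s≤s (s≤s z≤n)))) ⟩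
  (4 * n) ^ (2 + m)                           ≡⟨ ^-distribʳ-* (2 + m) 4 n ⟩
  4 ^ (2 + m) * n ^ (2 + m)                   ∎)
  where
  open ≤-Reasoning
  4q≤E : 4 * q ≤ E
  4q≤E = ^-cancelˡ-≤ (1 + m) (begin
    (4 * q) ^ (2 + m)                         ≡⟨ ^-distribʳ-* (2 + m) 4 q ⟩
    -- The exponent 2k+1 is at least k+1, so the size hypothesis already contains the (k+1)-st power
    -- of `4 * q ≤ E`.
    4 ^ (2 + m) * q ^ (2 + m)                 ≤⟨ *-monoʳ-≤ (4 ^ (2 + m)) (^-monoʳ-≤ q (m≤n+m (2 + m) (1 + m))) ⟩
    4 ^ (2 + m) * q ^ (1 + m + (2 + m))       ≡⟨ cong (λ k → 4 ^ (2 + m) * q ^ (1 + m + (2 + k))) (+-identityʳ m) ⟨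
    4 ^ (2 + m) * q ^ (2 * (2 + m) ∸ 1)       ≤⟨ hyp ⟩
    E ^ (2 + m)                               ∎)
  1≤n : 1 ≤ n
  1≤n = s≤s⁻¹ (≤-trans (s≤s (s≤s z≤n)) (≤-trans (*-monoʳ-≤ 4 (>-nonZero⁻¹ q)) (≤-trans 4q≤E E≤1+n)))
  E≤2n : E ≤ 2 * n
  E≤2n = ≤-trans E≤1+n (≤-trans (+-monoˡ-≤ n 1≤n) (≤-reflexive (cong (n +_) (sym (+-identityʳ n)))))
  2q≤n : 2 * q ≤ n
  2q≤n = *-cancelˡ-≤ 2 (≤-trans (≤-reflexive (sym (*-assoc 2 2 q))) (≤-trans 4q≤E E≤2n))

theorem1 : ∀ {c ℓ e : Level} (k : ℕ) → 1 ≤ k →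
    Σ[ C ∈ ℕ ] Σ[ K ∈ ℕ ]
    ((p n : ℕ) → Prime p → p ≢ 2 → 1 ≤ n →
    (F : FiniteField c ℓ) → FiniteField.order F ≡ p ^ n →
    (E : Subset (FiniteField.plane F) e) →
    ∣ subset (FiniteField.plane F) E ∣ ≥ C · (p ^ n) ^[ 2 * suc k ∸ 1 / suc k ] →
    ∣ classes F (suc k) (whole (FiniteField.plane F)) ∣ ≤ K * ∣ classes F (suc k) E ∣)
theorem1 (suc m) _ = 4 , K₁ * (4 * K₂) , λ p n _ _ _ F order≡p^n E large →
  bound F E (subst (λ q → ∣ subset (FiniteField.plane F) E ∣ ≥ 4 · q ^[ 2 * (2 + m) ∸ 1 / 2 + m ])
    (sym order≡p^n) large)
  where
  -- `K₁` counts the ordered pairs of positions that can be normalised, plus one for the zero tuple,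
  -- absorbed by `1 ≤ M`. `K₂` is the constant of `moment`, and the 4 multiplying it is the square
  -- of the 2 lost to dependent leading pairs.
  K₁ = 1 + (2 + m) * (1 + m)
  K₂ = 2 ^ (2 + m) + 8
  module _ {c ℓ e} (F : FiniteField c ℓ) (E : Subset (FiniteField.plane F) e) where
    open Incidence F using (q; N)
    open SpecialLinear F using (matrices; f)
    open Punctured F E
    open Moments F E∖0 proj₂
    open Representatives F m

    bound : ∣ subset (FiniteField.plane F) E ∣ ≥ 4 · q ^[ 2 * (2 + m) ∸ 1 / 2 + m ] →
            ∣ classes F (2 + m) (whole (FiniteField.plane F)) ∣ ≤ K₁ * (4 * K₂) * ∣ classes F (2 + m) E ∣
    bound large = begin
      ∣ classes F (2 + m) (whole (FiniteField.plane F)) ∣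
        ≤⟨ ∣classes-whole∣ ⟩
      1 + (2 + m) * (1 + m) * M
        ≤⟨ +-monoˡ-≤ _ 1≤M ⟩
      K₁ * M
        ≤⟨ *-monoʳ-≤ K₁ (*-cancelʳ-≤ M (4 * K₂ * X) (T ²) {{m*n≢0 T T}} main) ⟩
      K₁ * (4 * K₂ * X)
        ≡⟨ *-assoc K₁ (4 * K₂) X ⟨
      K₁ * (4 * K₂) * X ∎
      where
      open ≤-Reasoning
      instance
        q≢0 : NonZero q
        q≢0 = length-nonZero (Enumeration.list-complete (FiniteField.finiteSetoid F) (FiniteField.0# F))
      X = ∣ classes F (2 + m) E ∣
      M = q * (q ²) ^ m
      T = N E∖0 ^ (2 + m)
      N-large : 2 * q ≤ N E∖0 × q * q ² * (q ²) ^ m ≤ T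
      N-large = large-set q m ∣E∣-≤ large
      1≤M : 1 ≤ M
      1≤M = >-nonZero⁻¹ M {{m*n≢0 q ((q ²) ^ m) {{q≢0}} {{m^n≢0 (q ²) m {{m*n≢0 q q}}}}}}
      instance
        T≢0 : NonZero T
        T≢0 = m^n≢0 (N E∖0) (2 + m) {{>-nonZero (≤-trans (>-nonZero⁻¹ q) (≤-trans (m≤m+n q _) (proj₁ N-large)))}}
      Σf = ∑[ g ← matrices ] f E∖0 proj₂ g ^ (2 + m)
      I = independents m
      lemma₁ : ∀ M I → M * ((2 * I) * (2 * I)) ≡ 4 * M * (I * I)
      lemma₁ = solve-∀
      lemma₂ : ∀ M X s → 4 * M * (X * s) ≡ 4 * X * (M * s)
      lemma₂ = solve-∀
      lemma₃ : ∀ X K t → 4 * X * (K * t) ≡ 4 * K * X * t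
      lemma₃ = solve-∀
      main : M * T ² ≤ 4 * K₂ * X * T ²
      main = begin
        M * T ²              ≤⟨ *-monoʳ-≤ M (*-mono-≤ T≤2I T≤2I) ⟩
        M * (2 * I) ²        ≡⟨ lemma₁ M I ⟩
        4 * M * I ²          ≤⟨ *-monoʳ-≤ (4 * M) (independents-² m E proj₁) ⟩
        4 * M * (X * Σf)     ≡⟨ lemma₂ M X Σf ⟩
        4 * X * (M * Σf)     ≤⟨ *-monoʳ-≤ (4 * X) (moment m (proj₂ N-large)) ⟩
        4 * X * (K₂ * T ²)   ≡⟨ lemma₃ X K₂ (T ²) ⟩
        4 * K₂ * X * T ²     ∎
        where
        T≤2I : T ≤ 2 * I
        T≤2I = independents-≥ m (proj₁ N-large)
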